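{- For every integer $n\ge 1$ we have \[c_1(n)\equiv c_2(n)\equiv c_4(n)\equiv c_8(n)\equiv c_{16}(n)\pmod 2.\] Moreover: (1) If $n\ge1$ and $n\not\equiv 7\pmod 8$, then $c_1(n)\equiv 0\pmod 2$. (2) For every $n\ge 1$, $c_1(8n-1)\equiv c_{\mu_2}(n)\equiv c_{U_0}(n)\pmod 2$. (3) For every $n\ge 1$, $c_1(16n-1)\equiv c_{S_0}(n)\pmod 2$. (4) For every $n\ge 0$, $c_1(16n+7)\equiv c_{S_1}(n)\pmod 2$.
   Context: Let $q=e^{2\pi i\tau}$ with $\tau$ in the upper half-plane. Write $(a;q)_n=(a,q)_n=\prod_{k=0}^{n-1}(1-aq^k)$, $(q)_n=(q,q)_n$, and $(a,q)_\infty$, $(q)_\infty$ for the infinite products. Let $\eta(\tau)=q^{1/24}(q)_\infty$ and $\eta_k=\eta(k\tau)=q^{k/24}(q^k)_\infty$. Let $j(\tau)=E_4(\tau)^3/\Delta(\tau)$ be the elliptic modular $j$-function, where $E_4=1+240\sum_{n\ge1}\sigma_3(n)q^n$ and $\Delta=q\prod_{n\ge1}(1-q^n)^{24}$. Define the hauptmoduln $j_1=j$, $j_2=\eta_1^{24}/\eta_2^{24}$, $j_4=\eta_1^{8}/\eta_4^{8}$, $j_8=\eta_1^4\eta_4^2/(\eta_2^2\eta_8^4)$, $j_{16}=\eta_1^2\eta_8/(\eta_2\eta_{16}^2)$. Each has an expansion $j_N(\tau)=q^{ -1}+a_N+\sum_{n\ge1}c_N(n)q^n$; $c_N(n)$ denotes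 the $n$-th Fourier coefficient. For a $q$-series $f(q)$, $c_f(n)$ denotes the coefficient of $q^n$ in $f$. The mock theta functions are $\mu_2(q)=\sum_{n\ge0}\frac{(-1)^nq^{n^2}(q,q^2)_n}{(-q^2,q^2)_n^2}$ (2nd order), $U_0(q)=\sum_{n\ge0}\frac{q^{n^2}(-q,q^2)_n}{(-q^4,q^4)_n}$, $S_0(q)=\sum_{n\ge0}\frac{q^{n^2}(-q,q^2)_n}{(-q^2,q^2)_n}$, $S_1(q)=\sum_{n\ge0}\frac{q^{n(n+2)}(-q,q^2)_n}{(-q^2,q^2)_n}$ (8th order). -}

module Defs where

open import Data.Bool using (if_then_else_)
open import Data.Nat as ℕ using (ℕ; zero; suc; _∸_; _≡ᵇ_)
open import Data.Nat.Divisibility as ℕD using (_∣?_)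
open import Relation.Nullary.Decidable using (does)
open import Data.Integer as ℤ using (ℤ; +_; -_; _+_; _*_; _-_)
open import Data.Integer.Divisibility using (_∣_)

-- Formal power series in q with integer coefficients: n ↦ coefficient of q^n.
Series : Set
Series = ℕ → ℤ

sumTo : ℕ → (ℕ → ℤ) → ℤ
sumTo zero    f = + 0
sumTo (suc n) f = sumTo n f + f n

𝟙 : Series
𝟙 zero    = + 1
𝟙 (suc _) = + 0

mono : ℤ → ℕ → Series
mono c k n = if k ≡ᵇ n then c else + 0

infixl 6 _⊕_ _⊖_
infixl 7 _⊛_
_⊕_ _⊖_ _⊛_ : Series → Series → Series
(f ⊕ g) n = f n + g n
(f ⊖ g) n = f n - g n
(f ⊛ g) n = sumTo (suc n) (λ k → f k * g (n ∸ k))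

pow : Series → ℕ → Series
pow f zero    = 𝟙
pow f (suc m) = pow f m ⊛ f

sumS : ℕ → (ℕ → Series) → Series
sumS zero    F = λ _ → + 0
sumS (suc n) F = sumS n F ⊕ F n

prodS : ℕ → (ℕ → Series) → Series
prodS zero    F = 𝟙
prodS (suc n) F = prodS n F ⊛ F n

-- Formal infinite sum Σ_{k≥0} F k, for families with F k = O(q^k):
-- the coefficient of q^n only involves the terms k ≤ n.
sumInf : (ℕ → Series) → Series
sumInf F n = sumS (suc n) F n

-- Reciprocal 1/f of a series with constant term 1 (only used for such f):
-- 1/f = Σ_{m≥0} (1 - f)^m, where (1 - f)^m = O(q^m).
inv : Series → Series
inv f = sumInf (λ m → pow (𝟙 ⊖ f) m)

poch : ℤ → ℕ → ℕ → ℕ → Series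
poch c j d n = prodS n (λ k → 𝟙 ⊖ mono c (j ℕ.+ d ℕ.* k))

-- (q^d ; q^d)_∞ = ∏_{k≥0} (1 - q^{d(k+1)}), for d ≥ 1;
-- the coefficient of q^n only involves the factors with k ≤ n.
eulerInf : ℕ → Series
eulerInf d n = poch (+ 1) d d (suc n) n

σ₃ : ℕ → ℕ
σ₃ n = go n
  where
  go : ℕ → ℕ
  go zero    = 0
  go (suc d) = go d ℕ.+ (if does (suc d ∣? n) then suc d ℕ.^ 3 else 0)

E4 : Series
E4 zero    = + 1
E4 (suc n) = + (240 ℕ.* σ₃ (suc n))

-- Each hauptmodul is j_N = q^{-1} P_N with P_N a power series; c_N(n) = coeff of q^{n+1} in P_N.
-- j = E₄³/Δ = q^{-1} E₄³ / (q;q)_∞^24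
P₁ P₂ P₄ P₈ P₁₆ : Series
P₁  = pow E4 3 ⊛ inv (pow (eulerInf 1) 24)
-- η₁^24/η₂^24 = q^{-1} (q;q)^24/(q²;q²)^24
P₂  = pow (eulerInf 1) 24 ⊛ inv (pow (eulerInf 2) 24)
-- η₁^8/η₄^8 = q^{-1} (q;q)^8/(q⁴;q⁴)^8
P₄  = pow (eulerInf 1) 8 ⊛ inv (pow (eulerInf 4) 8)
-- η₁^4η₄^2/(η₂^2η₈^4)
P₈  = pow (eulerInf 1) 4 ⊛ pow (eulerInf 4) 2
      ⊛ inv (pow (eulerInf 2) 2 ⊛ pow (eulerInf 8) 4)
-- η₁^2η₈/(η₂η₁₆^2)
P₁₆ = pow (eulerInf 1) 2 ⊛ eulerInf 8
      ⊛ inv (eulerInf 2 ⊛ pow (eulerInf 16) 2)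

c₁ c₂ c₄ c₈ c₁₆ : ℕ → ℤ
c₁  n = P₁  (suc n)
c₂  n = P₂  (suc n)
c₄  n = P₄  (suc n)
c₈  n = P₈  (suc n)
c₁₆ n = P₁₆ (suc n)

sign : ℕ → ℤ
sign zero    = + 1
sign (suc n) = - sign n

μ₂ : Series
μ₂ = sumInf (λ n → mono (sign n) (n ℕ.* n) ⊛ poch (+ 1) 1 2 n
                    ⊛ inv (pow (poch (- + 1) 2 2 n) 2))

U₀ : Series
U₀ = sumInf (λ n → mono (+ 1) (n ℕ.* n) ⊛ poch (- + 1) 1 2 n
                    ⊛ inv (poch (- + 1) 4 4 n))

S₀ : Series
S₀ = sumInf (λ n → mono (+ 1) (n ℕ.* n) ⊛ poch (- + 1) 1 2 n
                    ⊛ inv (poch (- + 1) 2 2 n))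

S₁ : Series
S₁ = sumInf (λ n → mono (+ 1) (n ℕ.* (n ℕ.+ 2)) ⊛ poch (- + 1) 1 2 n
                    ⊛ inv (poch (- + 1) 2 2 n))

infix 4 _≡₂_
_≡₂_ : ℤ → ℤ → Set
a ≡₂ b = + 2 ∣ (a - b)

{-# OPTIONS --safe #-}
module Submission where

-- Write E for (q;q)_∞. Modulo 2 we have f(q²) = f(q)², so each of the five hauptmoduln is q⁻¹ E⁻²⁴, and
-- the coefficients of E⁻²⁴ are those of E⁻³ moved to the multiples of 8.
--
-- For every r, Σ_n q^(n²) (q;q²)_n / ((q²;q²)_{n-r} (q²;q²)_{n+r}) = q^(r²) C with
-- C = (q;q²)_∞ / (q²;q²)_∞ = E⁻³ (a limit of the q-Gauss sum).
-- The case r = 0 is the sum μ₂, and also U₀. Inserting 1/(q²;q²)_n = Σ_r q^(r(3r+1)) / ((q²;q²)_{n-r} (q²;q²)_{n+r})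
-- (signs are irrelevant) gives S₀ = C Σ_r q^(r(4r+1)) over r ∈ ℤ, and a variant gives S₁ = C Σ_r q^(r(4r+3)).
-- The same method applied to the unit Bailey pair gives 1 = C Σ_r q^(r(2r+1)), a sum over all triangular
-- numbers. Sorting these by parity yields S₀² + q S₁² = C² Σ_r q^(r(2r+1)) = C, that is, S₀ and S₁ are the
-- even and the odd part of E⁻³.
--
-- All identities are proved in 𝔽₂[q]/(q^N), where every sum and product involved is finite.

open import Defs
import Algebra.Properties.Semiring.Exp
import Algebra.Solver.Ring
import Data.Bool.Properties as Bool
import Data.Integer.Divisibility.Signed as Signed
import Data.Integer.Properties as ℤₚ
import Data.Integer.Tactic.RingSolver as ℤ-Solver
import Data.Nat.Properties as ℕₚ
import Relation.Binary.Reasoning.Setoid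
open import Algebra.Bundles using (CommutativeRing)
open import Algebra.Solver.Ring.AlmostCommutativeRing using (fromCommutativeRing; _-Raw-AlmostCommutative⟶_)
open import Data.Bool using (Bool; true; false)
open import Data.Integer as ℤ using (ℤ; +_)
open import Data.Maybe using (Maybe; just; nothing)
open import Data.Nat as ℕ using (ℕ; zero; suc; _≤_; _<_; z≤n; s≤s)
open import Data.Nat.DivMod using (m≡m%n+[m/n]*n; m%n<n)
open import Data.Nat.Tactic.RingSolver using (solve-∀)
open import Data.Product using (_,_; _×_)
open import Data.Sum using (inj₁; inj₂)
open import Level using (0ℓ)
open import Relation.Binary.PropositionalEquality as ≡ using (_≡_)
open import Relation.Nullary using (yes; no; ¬_; contradiction)

-- Since q is nilpotent, it cannot be divided by. Therefore 1/(q²;q²)_n enters only through its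
-- recurrence in n, a factor 1 - q^(2(n-r)) appears multiplied by q^(2r), and nothing is cancelled
-- except factors 1 + q^k with k ≥ 1. The hypergeometric sums are evaluated by telescoping: the
-- summand is its intended value plus G(k) + G(k+1) for an explicit G (no signs in characteristic
-- 2), and checking this is a polynomial identity in a few powers of q.
--
-- The q-Gauss limit is reached through a second parameter i in the summand. Passing from i to i + 1
-- divides the sum by 1 + q^(2(r+i)+1), and at i = N only the term m = 0 is left. The sum with i = 1
-- has a second use: it is the one that the exponent n(n+2) of S₁ calls for.

module Char2 {c ℓ} (R : CommutativeRing c ℓ)
  (1+1≈0 : CommutativeRing._≈_ R
     (CommutativeRing._+_ R (CommutativeRing.1# R) (CommutativeRing.1# R)) (CommutativeRing.0# R)) where

  open CommutativeRing R public
  open Algebra.Properties.Semiring.Exp semiring public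
  open Relation.Binary.Reasoning.Setoid setoid public

  -- Arithmetic in characteristic two.

  x+x≈0 : ∀ x → x + x ≈ 0#
  x+x≈0 x = begin
    x + x              ≈⟨ +-cong (*-identityˡ x) (*-identityˡ x) ⟨
    1# * x + 1# * x    ≈⟨ distribʳ x 1# 1# ⟨
    (1# + 1#) * x      ≈⟨ *-congʳ 1+1≈0 ⟩
    0# * x             ≈⟨ zeroˡ x ⟩
    0#                 ∎

  x+y≈0⇒x≈y : ∀ {x y} → x + y ≈ 0# → x ≈ y
  x+y≈0⇒x≈y {x} {y} x+y≈0 = begin
    x            ≈⟨ +-identityʳ x ⟨
    x + 0#       ≈⟨ +-congˡ (x+x≈0 y) ⟨
    x + (y + y)  ≈⟨ +-assoc x y y ⟨
    x + y + y    ≈⟨ +-congʳ x+y≈0 ⟩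
    0# + y       ≈⟨ +-identityˡ y ⟩
    y            ∎

  -x≈x : ∀ x → - x ≈ x
  -x≈x x = x+y≈0⇒x≈y (-‿inverseˡ x)

  private
    ⟦_⟧₂ : Bool → Carrier
    ⟦ false ⟧₂ = 0#
    ⟦ true  ⟧₂ = 1#

    morphism : CommutativeRing.rawRing Bool.xor-∧-commutativeRing
               -Raw-AlmostCommutative⟶ fromCommutativeRing R
    morphism = record
      { ⟦_⟧    = ⟦_⟧₂
      ; +-homo = λ { false _ → sym (+-identityˡ _)
                   ; true false → sym (+-identityʳ _)
                   ; true true → sym 1+1≈0 }
      ; *-homo = λ { false _ → sym (zeroˡ _) ; true _ → sym (*-identityˡ _) }
      ; -‿homo = λ x → sym (-x≈x ⟦ x ⟧₂)
      ; 0-homo = refl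
      ; 1-homo = refl
      }

    ⟦⟧₂-≟ : ∀ a b → Maybe (⟦ a ⟧₂ ≈ ⟦ b ⟧₂)
    ⟦⟧₂-≟ false false = just refl
    ⟦⟧₂-≟ true  true  = just refl
    ⟦⟧₂-≟ _     _     = nothing

  -- Coefficients are taken in 𝔽₂, so that the solver also knows x + x ≈ 0.
  module Solver = Algebra.Solver.Ring
    (CommutativeRing.rawRing Bool.xor-∧-commutativeRing) (fromCommutativeRing R) morphism ⟦⟧₂-≟

  open Solver using (solve; _:=_; _:+_; _:*_; _:^_; con; Polynomial)

  :1 : ∀ {n} → Polynomial n
  :1 = con true

  ^-+ : ∀ x {k} m n → k ≡ m ℕ.+ n → x ^ k ≈ x ^ m * x ^ n
  ^-+ x m n ≡.refl = ^-homo-* x m n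

  *-zero-l : ∀ {x} y → x ≈ 0# → x * y ≈ 0#
  *-zero-l y x≈0 = trans (*-congʳ x≈0) (zeroˡ y)

  *-zero-r : ∀ x {y} → y ≈ 0# → x * y ≈ 0#
  *-zero-r x y≈0 = trans (*-congˡ y≈0) (zeroʳ x)

  inverse-unique : ∀ {x y z} → x * y ≈ 1# → x * z ≈ 1# → y ≈ z
  inverse-unique {x} {y} {z} xy xz = begin
    y            ≈⟨ *-identityʳ y ⟨
    y * 1#       ≈⟨ *-congˡ xz ⟨
    y * (x * z)  ≈⟨ solve 3 (λ x y z → y :* (x :* z) := x :* y :* z) refl x y z ⟩
    x * y * z    ≈⟨ *-congʳ xy ⟩
    1# * z       ≈⟨ *-identityˡ z ⟩
    z            ∎

  -- Finite sums in characteristic two.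

  sum : ℕ → (ℕ → Carrier) → Carrier
  sum zero    F = 0#
  sum (suc n) F = sum n F + F n

  sum-cong< : ∀ n {F G} → (∀ k → k < n → F k ≈ G k) → sum n F ≈ sum n G
  sum-cong< zero    F≈G = refl
  sum-cong< (suc n) F≈G =
    +-cong (sum-cong< n λ k k<n → F≈G k (ℕₚ.m<n⇒m<1+n k<n)) (F≈G n ℕₚ.≤-refl)

  sum-cong : ∀ n {F G} → (∀ k → F k ≈ G k) → sum n F ≈ sum n G
  sum-cong n F≈G = sum-cong< n λ k _ → F≈G k

  sum-zero : ∀ n {F} → (∀ k → k < n → F k ≈ 0#) → sum n F ≈ 0#
  sum-zero zero    F≈0 = refl
  sum-zero (suc n) F≈0 = trans
    (+-cong (sum-zero n λ k k<n → F≈0 k (ℕₚ.m<n⇒m<1+n k<n)) (F≈0 n ℕₚ.≤-refl)) (+-identityˡ 0#)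

  sum-+ : ∀ n F G → sum n (λ k → F k + G k) ≈ sum n F + sum n G
  sum-+ zero    F G = sym (+-identityˡ 0#)
  sum-+ (suc n) F G = trans (+-congʳ (sum-+ n F G))
    (solve 4 (λ a b c d → a :+ b :+ (c :+ d) := a :+ c :+ (b :+ d)) refl _ _ _ _)

  sum-*ˡ : ∀ n x F → x * sum n F ≈ sum n (λ k → x * F k)
  sum-*ˡ zero    x F = zeroʳ x
  sum-*ˡ (suc n) x F = trans (distribˡ x _ _) (+-congʳ (sum-*ˡ n x F))

  sum-swap : ∀ m n (F : ℕ → ℕ → Carrier) → sum m (λ i → sum n (F i)) ≈ sum n (λ j → sum m (λ i → F i j))
  sum-swap zero    n F = sym (sum-zero n λ _ _ → refl)
  sum-swap (suc m) n F = trans (+-congʳ (sum-swap m n F)) (sym (sum-+ n _ _))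

  sum-split : ∀ m n F → sum (m ℕ.+ n) F ≈ sum m F + sum n (λ k → F (m ℕ.+ k))
  sum-split m zero    F rewrite ℕₚ.+-identityʳ m = sym (+-identityʳ _)
  sum-split m (suc n) F rewrite ℕₚ.+-suc m n = trans (+-congʳ (sum-split m n F)) (+-assoc _ _ _)

  sum-extend : ∀ {m n} F → m ≤ n → (∀ k → m ≤ k → F k ≈ 0#) → sum n F ≈ sum m F
  sum-extend {m} {n} F m≤n F≈0 = begin
    sum n F                                        ≡⟨ ≡.cong (λ l → sum l F) (≡.sym (ℕₚ.m+[n∸m]≡n m≤n)) ⟩
    sum (m ℕ.+ (n ℕ.∸ m)) F                        ≈⟨ sum-split m (n ℕ.∸ m) F ⟩
    sum m F + sum (n ℕ.∸ m) (λ k → F (m ℕ.+ k))    ≈⟨ +-congˡ (sum-zero (n ℕ.∸ m) λ k _ → F≈0 _ (ℕₚ.m≤m+n m k)) ⟩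
    sum m F + 0#                                   ≈⟨ +-identityʳ _ ⟩
    sum m F                                        ∎

  sum-head : ∀ n F → (∀ k → F (suc k) ≈ 0#) → sum (suc n) F ≈ F 0
  sum-head n F F≈0 = trans (sum-extend F (s≤s z≤n) λ { (suc k) _ → F≈0 k }) (+-identityˡ _)

  sum-telescope : ∀ n (G : ℕ → Carrier) → sum n (λ k → G k + G (suc k)) ≈ G 0 + G n
  sum-telescope zero    G = sym (x+x≈0 (G 0))
  sum-telescope (suc n) G = trans (+-congʳ (sum-telescope n G))
    (solve 3 (λ a b c → a :+ b :+ (b :+ c) := a :+ c) refl _ _ _)

  -- Frobenius for finite sums: every cross term occurs twice.
  sum-square : ∀ n F → sum n F * sum n F ≈ sum n (λ k → F k * F k)
  sum-square zero    F = zeroˡ 0#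
  sum-square (suc n) F = trans
    (solve 2 (λ s x → (s :+ x) :* (s :+ x) := s :* s :+ x :* x) refl _ _)
    (+-congʳ (sum-square n F))

  sum-pairs : ∀ n F → sum n (λ k → F (2 ℕ.* k) + F (suc (2 ℕ.* k))) ≈ sum (2 ℕ.* n) F
  sum-pairs zero    F = refl
  sum-pairs (suc n) F rewrite ℕₚ.+-suc n (n ℕ.+ 0) =
    trans (+-congʳ (sum-pairs n F)) (sym (+-assoc _ _ _))

  -- Eta quotients as powers of Euler's product.

  module Hauptmodul (E E⁻³ : Carrier) (E³E⁻³≈1 : E ^ 3 * E⁻³ ≈ 1#) where

    -- Bracketed as a threefold iterated square, because the coefficients are later read off by
    -- undoing one squaring at a time.
    E⁻²⁴ : Carrier
    E⁻²⁴ = (E⁻³ * E⁻³) * (E⁻³ * E⁻³) * ((E⁻³ * E⁻³) * (E⁻³ * E⁻³))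

    E²⁴E⁻²⁴≈1 : E ^ 24 * E⁻²⁴ ≈ 1#
    E²⁴E⁻²⁴≈1 = begin
      E ^ 24 * E⁻²⁴             ≈⟨ *-congʳ (^-assocʳ E 3 8) ⟨
      (E ^ 3) ^ 8 * E⁻²⁴        ≈⟨ solve 2 (λ b a → b :^ 8 :* (a :* a :* (a :* a) :* (a :* a :* (a :* a))) := (b :* a) :^ 8) refl (E ^ 3) E⁻³ ⟩
      (E ^ 3 * E⁻³) ^ 8         ≈⟨ ^-congˡ 8 E³E⁻³≈1 ⟩
      1# ^ 8                  ≈⟨ solve 0 (:1 :^ 8 := :1) refl ⟩
      1#                      ∎

    -- The difference 24 of the two exponents is the simple pole at the cusp: an eta quotient with
    -- factors η_k to the power r_k starts with q to the power Σ k r_k / 24, and modulo 2 it becomes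
    -- E to the power Σ k r_k when all k are powers of 2.
    quotient≈E⁻²⁴ : ∀ i {k} X D I → k ≡ 24 ℕ.+ i → X ≈ E ^ i → D ≈ E ^ k → D * I ≈ 1# → X * I ≈ E⁻²⁴
    quotient≈E⁻²⁴ i X D I ≡.refl X≈ D≈ DI≈1 = inverse-unique (begin
      E ^ 24 * (X * I)      ≈⟨ *-assoc _ _ _ ⟨
      E ^ 24 * X * I        ≈⟨ *-congʳ (*-congˡ X≈) ⟩
      E ^ 24 * E ^ i * I    ≈⟨ *-congʳ (^-homo-* E 24 i) ⟨
      E ^ (24 ℕ.+ i) * I    ≈⟨ *-congʳ D≈ ⟨
      D * I                 ≈⟨ DI≈1 ⟩
      1#                    ∎) E²⁴E⁻²⁴≈1

    ^-square : ∀ m {k} x y → k ≡ m ℕ.+ m → x ≈ E ^ m → y ≈ x * x → y ≈ E ^ k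
    ^-square m x y ≡.refl x≈ y≈ = trans y≈ (trans (*-cong x≈ x≈) (sym (^-homo-* E m m)))

    ^-power : ∀ m n {k} x → k ≡ m ℕ.* n → x ≈ E ^ m → x ^ n ≈ E ^ k
    ^-power m n x ≡.refl x≈ = trans (^-congˡ n x≈) (^-assocʳ E m n)

    ^-product : ∀ m n {k} x y → k ≡ m ℕ.+ n → x ≈ E ^ m → y ≈ E ^ n → x * y ≈ E ^ k
    ^-product m n x y ≡.refl x≈ y≈ = trans (*-cong x≈ y≈) (sym (^-homo-* E m n))

-- Arithmetic with a nilpotent q.

module Nilpotent {c ℓ} (R : CommutativeRing c ℓ)
  (1+1≈0 : CommutativeRing._≈_ R
     (CommutativeRing._+_ R (CommutativeRing.1# R) (CommutativeRing.1# R)) (CommutativeRing.0# R))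
  (q : CommutativeRing.Carrier R) (N : ℕ)
  (qᴺ≈0 : CommutativeRing._≈_ R
     (Algebra.Properties.Semiring.Exp._^_ (CommutativeRing.semiring R) q N) (CommutativeRing.0# R)) where

  open Char2 R 1+1≈0
  open Solver using (solve; _:=_; _:+_; _:*_; con)

  qᵏ≈0 : ∀ {k} → N ≤ k → q ^ k ≈ 0#
  qᵏ≈0 {k} N≤k = trans (^-+ q N (k ℕ.∸ N) (≡.sym (ℕₚ.m+[n∸m]≡n N≤k))) (*-zero-l _ qᴺ≈0)

  1+qᵏ≈1 : ∀ {k} → N ≤ k → 1# + q ^ k ≈ 1#
  1+qᵏ≈1 N≤k = trans (+-congˡ (qᵏ≈0 N≤k)) (+-identityʳ 1#)

  -- (1 + qᵏ⁺¹) x ≈ 0 means x ≈ qᵏ⁺¹ x, which can be iterated until the power of q vanishes.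
  1+q^-cancel₀ : ∀ k {x} → (1# + q ^ suc k) * x ≈ 0# → x ≈ 0#
  1+q^-cancel₀ k {x} eq = trans (iterate N) (*-zero-l x (qᵏ≈0 (ℕₚ.m≤m*n N (suc k))))
    where
    fixed : x ≈ q ^ suc k * x
    fixed = x+y≈0⇒x≈y (trans (solve 2 (λ x y → x :+ y :* x := (:1 :+ y) :* x) refl x (q ^ suc k)) eq)

    iterate : ∀ j → x ≈ q ^ (j ℕ.* suc k) * x
    iterate zero    = sym (*-identityˡ x)
    iterate (suc j) = begin
      x                                     ≈⟨ fixed ⟩
      q ^ suc k * x                         ≈⟨ *-congˡ (iterate j) ⟩
      q ^ suc k * (q ^ (j ℕ.* suc k) * x)   ≈⟨ *-assoc _ _ _ ⟨
      q ^ suc k * q ^ (j ℕ.* suc k) * x     ≈⟨ *-congʳ (^-homo-* q (suc k) (j ℕ.* suc k)) ⟨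
      q ^ (suc j ℕ.* suc k) * x             ∎

  1+q^-cancel : ∀ k {x y} → (1# + q ^ suc k) * x ≈ (1# + q ^ suc k) * y → x ≈ y
  1+q^-cancel k {x} {y} eq = x+y≈0⇒x≈y (1+q^-cancel₀ k
    (trans (distribˡ _ x y) (trans (+-congʳ eq) (x+x≈0 _))))

  -- This is (q;q²)_k without its signs.
  o : ℕ → Carrier
  o zero    = 1#
  o (suc k) = o k * (1# + q ^ suc (2 ℕ.* k))

  o-cancel : ∀ k {x y} → o k * x ≈ o k * y → x ≈ y
  o-cancel zero    eq = trans (sym (*-identityˡ _)) (trans eq (*-identityˡ _))
  o-cancel (suc k) eq = 1+q^-cancel (2 ℕ.* k) (o-cancel k
    (trans (sym (*-assoc _ _ _)) (trans eq (*-assoc _ _ _))))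

  o-stable : ∀ k → o (k ℕ.+ N) ≈ o N
  o-stable zero    = refl
  o-stable (suc k) = trans
    (*-cong (o-stable k) (1+qᵏ≈1 (ℕₚ.≤-trans (ℕₚ.m≤n+m N k) (ℕₚ.≤-trans (ℕₚ.m≤n*m (k ℕ.+ N) 2) (ℕₚ.n≤1+n _)))))
    (*-identityʳ _)

  -- The q-Gauss limit, with `p n` standing for 1/(q²;q²)_n.

  module Bailey (p : ℕ → Carrier) (p₀ : p 0 ≈ 1#)
    (p-step : ∀ n → p n ≈ (1# + q ^ (2 ℕ.* suc n)) * p (suc n)) where

    p-stable : ∀ k → p (k ℕ.+ N) ≈ p N
    p-stable zero    = refl
    p-stable (suc k) = begin
      p (suc k ℕ.+ N)            ≈⟨ *-identityˡ _ ⟨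
      1# * p (suc k ℕ.+ N)       ≈⟨ *-congʳ (1+qᵏ≈1 (ℕₚ.≤-trans (ℕₚ.m≤n+m N (suc k)) (ℕₚ.m≤n*m (suc k ℕ.+ N) 2))) ⟨
      _                          ≈⟨ p-step (k ℕ.+ N) ⟨
      p (k ℕ.+ N)                ≈⟨ p-stable k ⟩
      p N                        ∎

    C : Carrier
    C = o N * p N

    -- For i = 0 this is the summand q^(n²) (q;q²)_n / ((q²;q²)_{n-r} (q²;q²)_{n+r}) at n = m + r,
    -- with the factor q^(r²) taken out.
    t : ℕ → ℕ → ℕ → Carrier
    t r i m = q ^ (m ℕ.* m ℕ.+ 2 ℕ.* (r ℕ.+ i) ℕ.* m) * o (m ℕ.+ r) * p m * p (m ℕ.+ (2 ℕ.* r ℕ.+ i))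

    -- A contiguity relation with its telescoping certificate (1 + q^(2m)) t. With x = q^(2m), u =
    -- q^(2(r+i)+1) and v = q^(2r+1), all four terms share one factor, and what remains is 1 + xuv =
    -- (1 + u)x + (1 + x)(1 + xuv) + xu(1 + xv).
    t-telescopes : ∀ r i m → t r i m ≈ (1# + q ^ suc (2 ℕ.* (r ℕ.+ i))) * t r (suc i) m
                     + ((1# + q ^ (2 ℕ.* m)) * t r i m + (1# + q ^ (2 ℕ.* suc m)) * t r i (suc m))
    t-telescopes r i m = begin
      A * O * Pm * p (m ℕ.+ (2 ℕ.* r ℕ.+ i))
        ≈⟨ *-congˡ P-step ⟩
      A * O * Pm * ((1# + x * u * v) * P)
        ≈⟨ solve 7 (λ A O Pm P x u v →
             A :* O :* Pm :* ((:1 :+ x :* u :* v) :* P) :=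
             (:1 :+ u) :* (A :* x :* O :* Pm :* P) :+
             ((:1 :+ x) :* (A :* O :* Pm :* ((:1 :+ x :* u :* v) :* P)) :+
              A :* (x :* u) :* (O :* (:1 :+ x :* v)) :* Pm :* P)) refl A O Pm P x u v ⟩
      (1# + u) * (A * x * O * Pm * P) + ((1# + x) * (A * O * Pm * ((1# + x * u * v) * P)) + A * (x * u) * (O * (1# + x * v)) * Pm * P)
        ≈⟨ +-cong (*-congˡ t₁) (+-cong (*-congˡ (*-congˡ (sym P-step))) t₂) ⟩
      _ ∎
      where
      a = m ℕ.* m ℕ.+ 2 ℕ.* (r ℕ.+ i) ℕ.* m
      A = q ^ a
      O = o (m ℕ.+ r)
      Pm = p m
      P = p (suc (m ℕ.+ (2 ℕ.* r ℕ.+ i)))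
      x = q ^ (2 ℕ.* m)
      u = q ^ suc (2 ℕ.* (r ℕ.+ i))
      v = q ^ suc (2 ℕ.* r)

      e₁ : ∀ m r i → 2 ℕ.* suc (m ℕ.+ (2 ℕ.* r ℕ.+ i)) ≡ 2 ℕ.* m ℕ.+ suc (2 ℕ.* (r ℕ.+ i)) ℕ.+ suc (2 ℕ.* r)
      e₁ = solve-∀
      e₂ : ∀ m r i → m ℕ.* m ℕ.+ 2 ℕ.* (r ℕ.+ suc i) ℕ.* m ≡ m ℕ.* m ℕ.+ 2 ℕ.* (r ℕ.+ i) ℕ.* m ℕ.+ 2 ℕ.* m
      e₂ = solve-∀
      e₃ : ∀ m r i → suc m ℕ.* suc m ℕ.+ 2 ℕ.* (r ℕ.+ i) ℕ.* suc m
             ≡ m ℕ.* m ℕ.+ 2 ℕ.* (r ℕ.+ i) ℕ.* m ℕ.+ (2 ℕ.* m ℕ.+ suc (2 ℕ.* (r ℕ.+ i)))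
      e₃ = solve-∀
      e₄ : ∀ m r → suc (2 ℕ.* (m ℕ.+ r)) ≡ 2 ℕ.* m ℕ.+ suc (2 ℕ.* r)
      e₄ = solve-∀
      e₅ : ∀ m r i → m ℕ.+ (2 ℕ.* r ℕ.+ suc i) ≡ suc (m ℕ.+ (2 ℕ.* r ℕ.+ i))
      e₅ = solve-∀

      P-step : p (m ℕ.+ (2 ℕ.* r ℕ.+ i)) ≈ (1# + x * u * v) * P
      P-step = trans (p-step _) (*-congʳ (+-congˡ
        (trans (^-+ q (2 ℕ.* m ℕ.+ suc (2 ℕ.* (r ℕ.+ i))) (suc (2 ℕ.* r)) (e₁ m r i))
          (*-congʳ (^-homo-* q (2 ℕ.* m) (suc (2 ℕ.* (r ℕ.+ i))))))))

      t₁ : A * x * O * Pm * P ≈ t r (suc i) m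
      t₁ = *-cong (*-congʳ (*-congʳ (sym (^-+ q a (2 ℕ.* m) (e₂ m r i))))) (reflexive (≡.cong p (≡.sym (e₅ m r i))))

      t₂ : A * (x * u) * (O * (1# + x * v)) * Pm * P ≈ (1# + q ^ (2 ℕ.* suc m)) * t r i (suc m)
      t₂ = trans
        (*-congʳ (*-cong
          (*-cong (sym (trans (^-+ q a (2 ℕ.* m ℕ.+ suc (2 ℕ.* (r ℕ.+ i))) (e₃ m r i))
                               (*-congˡ (^-homo-* q (2 ℕ.* m) (suc (2 ℕ.* (r ℕ.+ i)))))))
                  (*-congˡ (+-congˡ (sym (^-+ q (2 ℕ.* m) (suc (2 ℕ.* r)) (e₄ m r))))))
          (p-step m)))
        (solve 5 (λ a b c d e → a :* b :* (c :* d) :* e := c :* (a :* b :* d :* e)) refl _ _ _ _ _)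

    -- Terms with m ≥ N vanish, so the range is complete; the additional index keeps m = 0 in it for
    -- every N.
    Y : ℕ → ℕ → Carrier
    Y r i = sum (suc N) (t r i)

    N≤m²+ : ∀ {m} k → N ≤ m → N ≤ m ℕ.* m ℕ.+ k
    N≤m²+ {zero}  k N≤m = ℕₚ.≤-trans N≤m z≤n
    N≤m²+ {suc m} k N≤m = ℕₚ.≤-trans N≤m (ℕₚ.≤-trans (ℕₚ.m≤m*n (suc m) (suc m)) (ℕₚ.m≤m+n _ k))

    Y-step : ∀ r i → Y r i ≈ (1# + q ^ suc (2 ℕ.* (r ℕ.+ i))) * Y r (suc i)
    Y-step r i = begin
      Y r i                               ≈⟨ sum-cong (suc N) (t-telescopes r i) ⟩
      sum (suc N) (λ m → U * t r (suc i) m + (G m + G (suc m)))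
                                          ≈⟨ sum-+ (suc N) _ _ ⟩
      sum (suc N) (λ m → U * t r (suc i) m) + sum (suc N) (λ m → G m + G (suc m))
                                          ≈⟨ +-cong (sym (sum-*ˡ (suc N) U _)) (sum-telescope (suc N) G) ⟩
      -- The lower boundary term has the factor 1 + q^0 = 1 + 1, the upper one contains a power of q
      -- beyond N.
      U * Y r (suc i) + (G 0 + G (suc N)) ≈⟨ +-congˡ (+-cong (*-zero-l _ 1+1≈0) G-end) ⟩
      U * Y r (suc i) + (0# + 0#)         ≈⟨ solve 1 (λ y → y :+ (con false :+ con false) := y) refl _ ⟩
      U * Y r (suc i)                     ∎
      where
      U = 1# + q ^ suc (2 ℕ.* (r ℕ.+ i))
      G : ℕ → Carrier
      G m = (1# + q ^ (2 ℕ.* m)) * t r i m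
      G-end : G (suc N) ≈ 0#
      G-end = *-zero-r _ (*-zero-l _ (*-zero-l _ (*-zero-l _ (qᵏ≈0 (N≤m²+ (2 ℕ.* (r ℕ.+ i) ℕ.* suc N) (ℕₚ.n≤1+n N))))))

    -- The factors produced by `Y-step` are exactly the consecutive factors by which `o` grows.
    o*Y : ∀ r i → o r * Y r 0 ≈ o (i ℕ.+ r) * Y r i
    o*Y r zero    = refl
    o*Y r (suc i) = trans (o*Y r i) (trans (*-congˡ (Y-step r i))
      (trans (sym (*-assoc _ _ _)) (*-congʳ (*-congˡ (+-congˡ
        (reflexive (≡.cong (λ k → q ^ suc (2 ℕ.* k)) (ℕₚ.+-comm r i))))))))

    -- At i = N the exponent contains 2Nm, which kills every term with m ≥ 1.
    Y-limit : ∀ r → Y r N ≈ o r * p N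
    Y-limit r = begin
      Y r N                                ≈⟨ sum-head N (t r N) (λ m → *-zero-l _ (*-zero-l _ (*-zero-l _ (qᵏ≈0 (bound m))))) ⟩
      q ^ (2 ℕ.* (r ℕ.+ N) ℕ.* 0) * o r * p 0 * p (2 ℕ.* r ℕ.+ N)
                                           ≈⟨ *-cong (*-cong (*-congʳ (reflexive (≡.cong (q ^_) (ℕₚ.*-zeroʳ (2 ℕ.* (r ℕ.+ N)))))) p₀) (p-stable (2 ℕ.* r)) ⟩
      1# * o r * 1# * p N                  ≈⟨ solve 2 (λ a b → :1 :* a :* :1 :* b := a :* b) refl _ _ ⟩
      o r * p N                            ∎
      where
      e : ∀ m r n → suc m ℕ.* suc m ℕ.+ 2 ℕ.* (r ℕ.+ n) ℕ.* suc m
            ≡ n ℕ.+ (suc m ℕ.* suc m ℕ.+ 2 ℕ.* r ℕ.* suc m ℕ.+ n ℕ.+ 2 ℕ.* n ℕ.* m)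
      e = solve-∀
      bound : ∀ m → N ≤ suc m ℕ.* suc m ℕ.+ 2 ℕ.* (r ℕ.+ N) ℕ.* suc m
      bound m rewrite e m r N = ℕₚ.m≤m+n N _

    -- The product `o (N + r)` has already stabilised and `o r` cancels, so no dependence on r
    -- survives.
    Y≈C : ∀ r → Y r 0 ≈ C
    Y≈C r = o-cancel r (begin
      o r * Y r 0           ≈⟨ o*Y r N ⟩
      o (N ℕ.+ r) * Y r N   ≈⟨ *-cong (trans (reflexive (≡.cong o (ℕₚ.+-comm N r))) (o-stable r)) (Y-limit r) ⟩
      o N * (o r * p N)     ≈⟨ solve 3 (λ a b c → a :* (b :* c) := b :* (a :* c)) refl _ _ _ ⟩
      o r * C               ∎)

    -- This is 1/(q²;q²)_{n-r}, with the usual convention that the reciprocal is 0 for r > n. It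
    -- lets all sums over r run over one range independent of n.
    p̂ : ℕ → ℕ → Carrier
    p̂ n       zero    = p n
    p̂ zero    (suc r) = 0#
    p̂ (suc n) (suc r) = p̂ n r

    p̂-zero : ∀ {n r} → n < r → p̂ n r ≈ 0#
    p̂-zero {zero}  (s≤s n<r) = refl
    p̂-zero {suc n} (s≤s n<r) = p̂-zero n<r

    p̂-+ : ∀ r m → p̂ (r ℕ.+ m) r ≡ p m
    p̂-+ zero    m = ≡.refl
    p̂-+ (suc r) m = p̂-+ r m

    -- p̂ n (r + 1) = (1 + q^(2(n - r))) p̂ n r, multiplied by q^(2r) so that no subtraction occurs.
    p̂-step : ∀ n r → q ^ (2 ℕ.* r) * p̂ n (suc r) ≈ (q ^ (2 ℕ.* r) + q ^ (2 ℕ.* n)) * p̂ n r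
    p̂-step zero    zero    = trans (zeroʳ _) (sym (*-zero-l _ 1+1≈0))
    p̂-step (suc n) zero    = trans (*-identityˡ _) (p-step n)
    p̂-step zero    (suc r) = trans (zeroʳ _) (sym (zeroʳ _))
    p̂-step (suc n) (suc r) = begin
      q ^ (2 ℕ.* suc r) * p̂ n (suc r)
        ≈⟨ *-congʳ (two r) ⟩
      q ^ 2 * q ^ (2 ℕ.* r) * p̂ n (suc r)
        ≈⟨ *-assoc _ _ _ ⟩
      q ^ 2 * (q ^ (2 ℕ.* r) * p̂ n (suc r))
        ≈⟨ *-congˡ (p̂-step n r) ⟩
      q ^ 2 * ((q ^ (2 ℕ.* r) + q ^ (2 ℕ.* n)) * p̂ n r)
        ≈⟨ solve 4 (λ a b c d → a :* ((b :+ c) :* d) := (a :* b :+ a :* c) :* d) refl (q ^ 2) _ _ _ ⟩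
      (q ^ 2 * q ^ (2 ℕ.* r) + q ^ 2 * q ^ (2 ℕ.* n)) * p̂ n r
        ≈⟨ *-congʳ (+-cong (two r) (two n)) ⟨
      (q ^ (2 ℕ.* suc r) + q ^ (2 ℕ.* suc n)) * p̂ n r ∎
      where
      two : ∀ k → q ^ (2 ℕ.* suc k) ≈ q ^ 2 * q ^ (2 ℕ.* k)
      two k = ^-+ q 2 (2 ℕ.* k) (ℕₚ.*-suc 2 k)

    -- Two Bailey pairs for 1/(q²;q²)_n.

    p-step-+ : ∀ n r → p (n ℕ.+ r) ≈ (1# + q ^ (2 ℕ.* n) * q ^ (2 ℕ.* r) * q ^ 2) * p (suc (n ℕ.+ r))
    p-step-+ n r = trans (p-step (n ℕ.+ r)) (*-congʳ (+-congˡ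
      (trans (^-+ q (2 ℕ.* n ℕ.+ 2 ℕ.* r) 2 (e n r)) (*-congʳ (^-homo-* q (2 ℕ.* n) (2 ℕ.* r))))))
      where
      e : ∀ n r → 2 ℕ.* suc (n ℕ.+ r) ≡ 2 ℕ.* n ℕ.+ 2 ℕ.* r ℕ.+ 2
      e = solve-∀

    -- κ r = 3r² - r, twice a pentagonal number.
    κ : ℕ → ℕ
    κ zero    = 0
    κ (suc r) = κ r ℕ.+ (6 ℕ.* r ℕ.+ 2)

    κ+r : ∀ r → κ r ℕ.+ r ≡ 3 ℕ.* (r ℕ.* r)
    κ+r zero    = ≡.refl
    κ+r (suc r) = ≡.trans (e₁ (κ r) r) (≡.trans (≡.cong (ℕ._+ (6 ℕ.* r ℕ.+ 3)) (κ+r r)) (e₂ r))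
      where
      e₁ : ∀ k r → k ℕ.+ (6 ℕ.* r ℕ.+ 2) ℕ.+ suc r ≡ k ℕ.+ r ℕ.+ (6 ℕ.* r ℕ.+ 3)
      e₁ = solve-∀
      e₂ : ∀ r → 3 ℕ.* (r ℕ.* r) ℕ.+ (6 ℕ.* r ℕ.+ 3) ≡ 3 ℕ.* (suc r ℕ.* suc r)
      e₂ = solve-∀

    qκ-suc : ∀ r → q ^ κ (suc r) ≈ q ^ κ r * (q ^ (2 ℕ.* r) * q ^ (2 ℕ.* r) * q ^ (2 ℕ.* r) * q ^ 2)
    qκ-suc r = trans (^-homo-* q (κ r) (6 ℕ.* r ℕ.+ 2)) (*-congˡ
      (trans (^-homo-* q (6 ℕ.* r) 2) (*-congʳ
        (trans (^-+ q (2 ℕ.* r ℕ.+ 2 ℕ.* r) (2 ℕ.* r) (e r)) (*-congʳ (^-homo-* q (2 ℕ.* r) (2 ℕ.* r)))))))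
      where
      e : ∀ r → 6 ℕ.* r ≡ 2 ℕ.* r ℕ.+ 2 ℕ.* r ℕ.+ 2 ℕ.* r
      e = solve-∀

    h : ℕ → ℕ → Carrier
    h n r = q ^ κ r * (p̂ n r * p (n ℕ.+ r))

    -- The sum over all integers r with exponent r(3r+1) is folded onto the naturals by pairing r
    -- with -(r+1). `odd-term` is the same pair regrouped over 1/((q²;q²)_{n-r} (q²;q²)_{n+r+1}): in
    -- base q² these are the kernels of Bailey pairs relative to 1 and to q².
    even-term odd-term : ℕ → ℕ → Carrier
    even-term n r = q ^ (2 ℕ.* r) * h n r + h n (suc r)
    odd-term  n r = q ^ κ r * q ^ (2 ℕ.* r) * (1# + q ^ (2 ℕ.* r) * q ^ (2 ℕ.* r) * q ^ 2)
                    * (p̂ n r * p (suc (n ℕ.+ r)))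

    -- Once both terms are multiples of `p̂ n r * p (suc (n + r))`, the parts containing q^(2n)
    -- cancel, which leaves a coefficient that depends on r alone.
    even≈odd : ∀ n r → even-term n r ≈ odd-term n r
    even≈odd n r = begin
      z * (A * (X * p (n ℕ.+ r))) + q ^ κ (suc r) * (X' * p (n ℕ.+ suc r))
        ≈⟨ +-cong (*-congˡ (*-congˡ (*-congˡ (p-step-+ n r))))
                  (*-cong (qκ-suc r) (*-congˡ (reflexive (≡.cong p (ℕₚ.+-suc n r))))) ⟩
      z * (A * (X * ((1# + ν * z * Q) * P))) + A * (z * z * z * Q) * (X' * P)
        ≈⟨ solve 7 (λ z A X X' ν Q P →
             z :* (A :* (X :* ((:1 :+ ν :* z :* Q) :* P))) :+ A :* (z :* z :* z :* Q) :* (X' :* P) :=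
             z :* (A :* (X :* ((:1 :+ ν :* z :* Q) :* P))) :+ A :* (z :* z :* Q) :* (z :* X') :* P) refl z A X X' ν Q P ⟩
      z * (A * (X * ((1# + ν * z * Q) * P))) + A * (z * z * Q) * (z * X') * P
        ≈⟨ +-congˡ (*-congʳ (*-congˡ (p̂-step n r))) ⟩
      z * (A * (X * ((1# + ν * z * Q) * P))) + A * (z * z * Q) * ((z + ν) * X) * P
        ≈⟨ solve 6 (λ z A X ν Q P →
             z :* (A :* (X :* ((:1 :+ ν :* z :* Q) :* P))) :+ A :* (z :* z :* Q) :* ((z :+ ν) :* X) :* P :=
             A :* z :* (:1 :+ z :* z :* Q) :* (X :* P)) refl z A X ν Q P ⟩
      odd-term n r ∎
      where
      A = q ^ κ r
      Q = q ^ 2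
      X = p̂ n r
      X' = p̂ n (suc r)
      P = p (suc (n ℕ.+ r))
      z = q ^ (2 ℕ.* r)
      ν = q ^ (2 ℕ.* n)

    -- Combined with `even≈odd`, this gives the sum over r the same recurrence in n as `p`. The last
    -- two summands are values of one function at r and r + 1.
    odd-telescopes : ∀ n r → odd-term n r ≈ (1# + q ^ (2 ℕ.* suc n)) * even-term (suc n) r
      + (q ^ (2 ℕ.* suc n) * ((1# + q ^ (2 ℕ.* r)) * h (suc n) r)
       + q ^ (2 ℕ.* suc n) * ((1# + q ^ (2 ℕ.* suc r)) * h (suc n) (suc r)))
    odd-telescopes n r = sym (begin
      (1# + ν) * (z * (A * (X₀ * Y₀)) + h₁) + (ν * ((1# + z) * (A * (X₀ * Y₀))) + ν * ((1# + q ^ (2 ℕ.* suc r)) * h₁))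
        ≈⟨ +-cong (*-congˡ (+-congˡ h₁≈)) (+-congˡ (*-congˡ (*-cong (+-congˡ (^-+ q 2 (2 ℕ.* r) (ℕₚ.*-suc 2 r))) h₁≈))) ⟩
      (1# + ν) * (z * (A * (X₀ * Y₀)) + B) + (ν * ((1# + z) * (A * (X₀ * Y₀))) + ν * ((1# + Q * z) * B))
        ≈⟨ solve 8 (λ z A ν X₀ Y₀ X Y₁ Q →
             (:1 :+ ν) :* (z :* (A :* (X₀ :* Y₀)) :+ A :* (z :* z :* z :* Q) :* (X :* Y₁)) :+
             (ν :* ((:1 :+ z) :* (A :* (X₀ :* Y₀))) :+ ν :* ((:1 :+ Q :* z) :* (A :* (z :* z :* z :* Q) :* (X :* Y₁)))) :=
             A :* Y₀ :* ((z :+ ν) :* X₀) :+ A :* (z :* z :* z :* Q) :* X :* ((:1 :+ ν :* z :* Q) :* Y₁))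
             refl z A ν X₀ Y₀ X Y₁ Q ⟩
      A * Y₀ * ((z + ν) * X₀) + A * (z * z * z * Q) * X * ((1# + ν * z * Q) * Y₁)
        ≈⟨ +-cong (*-congˡ (p̂-step (suc n) r)) (*-congˡ (trans (p-step-+ (suc n) r) (*-congˡ (reflexive (≡.cong p (≡.sym (ℕₚ.+-suc (suc n) r))))))) ⟨
      A * Y₀ * (z * X) + A * (z * z * z * Q) * X * Y₀
        ≈⟨ solve 5 (λ z A Y₀ X Q →
             A :* Y₀ :* (z :* X) :+ A :* (z :* z :* z :* Q) :* X :* Y₀ :=
             A :* z :* (:1 :+ z :* z :* Q) :* (X :* Y₀)) refl z A Y₀ X Q ⟩
      odd-term n r ∎)
      where
      A = q ^ κ r
      Q = q ^ 2
      X₀ = p̂ (suc n) r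
      X = p̂ n r
      Y₀ = p (suc (n ℕ.+ r))
      Y₁ = p (suc n ℕ.+ suc r)
      z = q ^ (2 ℕ.* r)
      ν = q ^ (2 ℕ.* suc n)
      h₁ = h (suc n) (suc r)
      B = A * (z * z * z * Q) * (X * Y₁)
      h₁≈ : h₁ ≈ B
      -- `p̂ (suc n) (suc r)` computes to `p̂ n r`, so only the power of q has to be rewritten.
      h₁≈ = *-congʳ (qκ-suc r)

    even-sum-step : ∀ {R} n → suc n < R →
      sum R (even-term n) ≈ (1# + q ^ (2 ℕ.* suc n)) * sum R (even-term (suc n))
    even-sum-step {R} n n<R = begin
      sum R (even-term n)                        ≈⟨ sum-cong R (λ r → trans (even≈odd n r) (odd-telescopes n r)) ⟩
      sum R (λ r → U * even-term (suc n) r + (G r + G (suc r)))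
                                                 ≈⟨ sum-+ R _ _ ⟩
      _                                          ≈⟨ +-cong (sym (sum-*ˡ R U _)) (sum-telescope R G) ⟩
      -- Here the upper boundary vanishes because R exceeds n + 1 and `p̂` is zero there; the lower
      -- one again has the factor 1 + 1.
      U * sum R (even-term (suc n)) + (G 0 + G R)
                                                 ≈⟨ +-congˡ (+-cong (*-zero-r _ (*-zero-l _ 1+1≈0))
                                                      (*-zero-r _ (*-zero-r _ (*-zero-r _ (*-zero-l _ (p̂-zero n<R)))))) ⟩
      U * sum R (even-term (suc n)) + (0# + 0#)  ≈⟨ solve 1 (λ y → y :+ (con false :+ con false) := y) refl _ ⟩
      U * sum R (even-term (suc n))              ∎
      where
      U = 1# + q ^ (2 ℕ.* suc n)
      G : ℕ → Carrier
      G r = q ^ (2 ℕ.* suc n) * ((1# + q ^ (2 ℕ.* r)) * h (suc n) r)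

    h₀-zero : ∀ r → h 0 (suc r) ≈ 0#
    h₀-zero r = *-zero-r _ (zeroˡ _)

    p≈even-sum : ∀ {R} n → n < R → p n ≈ sum R (even-term n)
    p≈even-sum {suc R} zero _ = sym (begin
      sum (suc R) (even-term 0)        ≈⟨ sum-head R (even-term 0) (λ r → trans (+-cong (*-zero-r _ (h₀-zero r)) (h₀-zero (suc r))) (+-identityˡ 0#)) ⟩
      1# * (1# * (p 0 * p 0)) + h 0 1  ≈⟨ +-cong (*-congˡ (*-congˡ (*-congʳ p₀))) (h₀-zero 0) ⟩
      1# * (1# * (1# * p 0)) + 0#      ≈⟨ solve 1 (λ y → :1 :* (:1 :* (:1 :* y)) :+ con false := y) refl _ ⟩
      p 0                              ∎)
    -- The argument of the cancellation is the predecessor of the normal form of `2 * suc n`.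
    p≈even-sum {R} (suc n) n<R = 1+q^-cancel (n ℕ.+ suc (n ℕ.+ 0)) (begin
      _                          ≈⟨ p-step n ⟨
      p n                        ≈⟨ p≈even-sum n (ℕₚ.<-trans (ℕₚ.n<1+n n) n<R) ⟩
      sum R (even-term n)        ≈⟨ even-sum-step n n<R ⟩
      _                          ∎)

    p≈odd-sum : ∀ {R} n → n < R → p n ≈ sum R (odd-term n)
    p≈odd-sum {R} n n<R = trans (p≈even-sum n n<R) (sum-cong R (even≈odd n))

    -- The unit Bailey pair.

    τ : ℕ → ℕ
    τ zero    = 0
    τ (suc r) = τ r ℕ.+ 2 ℕ.* r

    τ+r : ∀ r → τ r ℕ.+ r ≡ r ℕ.* r
    τ+r zero    = ≡.refl
    τ+r (suc r) = ≡.trans (e₁ (τ r) r) (≡.trans (≡.cong (ℕ._+ suc (2 ℕ.* r)) (τ+r r)) (e₂ r))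
      where
      e₁ : ∀ k r → k ℕ.+ 2 ℕ.* r ℕ.+ suc r ≡ k ℕ.+ r ℕ.+ suc (2 ℕ.* r)
      e₁ = solve-∀
      e₂ : ∀ r → r ℕ.* r ℕ.+ suc (2 ℕ.* r) ≡ suc r ℕ.* suc r
      e₂ = solve-∀

    -- The unit pair in base q² has coefficients q^(r²-r) + q^(r²+r) at r ≥ 1, up to sign. Terms are
    -- collected here by the power of q: r and r + 1 share q^(r(r+1)).
    unit-term : ℕ → ℕ → Carrier
    unit-term n r = q ^ τ (suc r) * (p̂ n r * p (n ℕ.+ r) + p̂ n (suc r) * p (n ℕ.+ suc r))

    unit-primitive : ℕ → ℕ → Carrier
    unit-primitive n r = q ^ (2 ℕ.* n) * q ^ τ r * (1# + q ^ (2 ℕ.* r)) * (p̂ n r * p (n ℕ.+ r))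

    -- Only after multiplication by 1 + q^(2n) does the sum telescope. For n ≥ 1 this factor can be
    -- cancelled and the sum is 0; for n = 0 the factor is itself 0 and the value 1 is found
    -- directly.
    unit-telescopes : ∀ n r →
      (1# + q ^ (2 ℕ.* n)) * unit-term n r ≈ unit-primitive n r + unit-primitive n (suc r)
    unit-telescopes n r = begin
      (1# + ν) * (q ^ τ (suc r) * (X * p (n ℕ.+ r) + X' * p (n ℕ.+ suc r)))
        ≈⟨ *-congˡ (*-cong (^-homo-* q (τ r) (2 ℕ.* r)) (+-cong (*-congˡ P₀≈) (*-congˡ P₁≈))) ⟩
      (1# + ν) * (T * z * (X * ((1# + ν * z * Q) * P) + X' * P))
        ≈⟨ solve 7 (λ T z ν Q X X' P →
             (:1 :+ ν) :* (T :* z :* (X :* ((:1 :+ ν :* z :* Q) :* P) :+ X' :* P)) :=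
             (:1 :+ ν) :* (T :* z :* (X :* ((:1 :+ ν :* z :* Q) :* P))) :+ (:1 :+ ν) :* T :* P :* (z :* X')) refl T z ν Q X X' P ⟩
      (1# + ν) * (T * z * (X * ((1# + ν * z * Q) * P))) + (1# + ν) * T * P * (z * X')
        ≈⟨ +-congˡ (*-congˡ (p̂-step n r)) ⟩
      (1# + ν) * (T * z * (X * ((1# + ν * z * Q) * P))) + (1# + ν) * T * P * ((z + ν) * X)
        ≈⟨ solve 6 (λ T z ν Q X P →
             (:1 :+ ν) :* (T :* z :* (X :* ((:1 :+ ν :* z :* Q) :* P))) :+ (:1 :+ ν) :* T :* P :* ((z :+ ν) :* X) :=
             ν :* T :* (:1 :+ z) :* (X :* ((:1 :+ ν :* z :* Q) :* P)) :+ ν :* T :* (:1 :+ Q :* z) :* P :* ((z :+ ν) :* X)) refl T z ν Q X P ⟩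
      ν * T * (1# + z) * (X * ((1# + ν * z * Q) * P)) + ν * T * (1# + Q * z) * P * ((z + ν) * X)
        ≈⟨ +-cong (*-congˡ (*-congˡ P₀≈)) (*-congˡ (p̂-step n r)) ⟨
      ν * T * (1# + z) * (X * p (n ℕ.+ r)) + ν * T * (1# + Q * z) * P * (z * X')
        ≈⟨ +-congˡ (solve 6 (λ T z ν Q X' P →
             ν :* T :* (:1 :+ Q :* z) :* P :* (z :* X') := ν :* (T :* z) :* (:1 :+ Q :* z) :* (X' :* P)) refl T z ν Q X' P) ⟩
      ν * T * (1# + z) * (X * p (n ℕ.+ r)) + ν * (T * z) * (1# + Q * z) * (X' * P)
        ≈⟨ +-congˡ (*-cong (*-cong (*-congˡ (^-homo-* q (τ r) (2 ℕ.* r))) (+-congˡ (^-+ q 2 (2 ℕ.* r) (ℕₚ.*-suc 2 r)))) (*-congˡ P₁≈)) ⟨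
      unit-primitive n r + unit-primitive n (suc r) ∎
      where
      T = q ^ τ r
      Q = q ^ 2
      X = p̂ n r
      X' = p̂ n (suc r)
      P = p (suc (n ℕ.+ r))
      z = q ^ (2 ℕ.* r)
      ν = q ^ (2 ℕ.* n)
      P₀≈ : p (n ℕ.+ r) ≈ (1# + ν * z * Q) * P
      P₀≈ = p-step-+ n r
      P₁≈ : p (n ℕ.+ suc r) ≈ P
      P₁≈ = reflexive (≡.cong p (ℕₚ.+-suc n r))

    unit-sum-zero : ∀ {R} → 0 < R → sum R (unit-term 0) ≈ 1#
    unit-sum-zero {suc R} _ = begin
      sum (suc R) (unit-term 0)          ≈⟨ sum-head R (unit-term 0) (λ r → *-zero-r _ (trans (+-cong (zeroˡ _) (zeroˡ _)) (+-identityˡ 0#))) ⟩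
      1# * (p 0 * p 0 + 0# * p 1)        ≈⟨ *-congˡ (+-cong (*-cong p₀ p₀) (zeroˡ _)) ⟩
      1# * (1# * 1# + 0#)                ≈⟨ solve 0 (:1 :* (:1 :* :1 :+ con false) := :1) refl ⟩
      1#                                 ∎

    unit-sum-suc : ∀ {R} n → suc n < R → sum R (unit-term (suc n)) ≈ 0#
    unit-sum-suc {R} n n<R = 1+q^-cancel₀ (n ℕ.+ suc (n ℕ.+ 0)) (begin
      _                                                              ≈⟨ sum-*ˡ R _ _ ⟩
      _                                                              ≈⟨ sum-cong R (unit-telescopes (suc n)) ⟩
      _                                                              ≈⟨ sum-telescope R (unit-primitive (suc n)) ⟩
      unit-primitive (suc n) 0 + unit-primitive (suc n) R            ≈⟨ +-cong (*-zero-l _ (*-zero-r _ 1+1≈0)) (*-zero-r _ (*-zero-l _ (p̂-zero n<R))) ⟩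
      0# + 0#                                                        ≈⟨ +-identityˡ 0# ⟩
      0#                                                             ∎)

    -- Bailey's lemma and the theta series it produces.

    weight : ℕ → ℕ → Carrier
    weight s n = q ^ (n ℕ.* n ℕ.+ 2 ℕ.* s ℕ.* n) * o n

    weight-zero : ∀ s {n} → N ≤ n → weight s n ≈ 0#
    weight-zero s {n} N≤n = *-zero-l _ (qᵏ≈0 (N≤m²+ (2 ℕ.* s ℕ.* n) N≤n))

    -- Substituting n = r + m turns the summand into a power of q times `t r s m`: the shift s,
    -- which is 0 for S₀ and 1 for S₁, takes the place of the parameter i.
    weighted-shift : ∀ s r → sum (suc N) (λ n → weight s n * (p̂ n r * p (n ℕ.+ (r ℕ.+ s))))
                             ≈ q ^ (r ℕ.* r ℕ.+ 2 ℕ.* s ℕ.* r) * Y r s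
    weighted-shift s r = begin
      -- The range is lengthened by r beforehand, so that `suc N` indices remain once the first r,
      -- where `p̂` is zero, are split off.
      sum (suc N) F                                    ≈⟨ sum-extend F (ℕₚ.m≤n+m (suc N) r) (λ n N<n → *-zero-l _ (weight-zero s (ℕₚ.<⇒≤ N<n))) ⟨
      sum (r ℕ.+ suc N) F                              ≈⟨ sum-split r (suc N) F ⟩
      sum r F + sum (suc N) (λ m → F (r ℕ.+ m))        ≈⟨ +-cong (sum-zero r λ n n<r → *-zero-r _ (*-zero-l _ (p̂-zero n<r)))
                                                                 (sum-cong (suc N) shift) ⟩
      0# + sum (suc N) (λ m → q ^ b * t r s m)         ≈⟨ +-identityˡ _ ⟩
      sum (suc N) (λ m → q ^ b * t r s m)              ≈⟨ sum-*ˡ (suc N) _ _ ⟨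
      q ^ b * Y r s                                    ∎
      where
      b = r ℕ.* r ℕ.+ 2 ℕ.* s ℕ.* r
      F : ℕ → Carrier
      F n = weight s n * (p̂ n r * p (n ℕ.+ (r ℕ.+ s)))
      e₁ : ∀ m r s → (r ℕ.+ m) ℕ.* (r ℕ.+ m) ℕ.+ 2 ℕ.* s ℕ.* (r ℕ.+ m)
             ≡ r ℕ.* r ℕ.+ 2 ℕ.* s ℕ.* r ℕ.+ (m ℕ.* m ℕ.+ 2 ℕ.* (r ℕ.+ s) ℕ.* m)
      e₁ = solve-∀
      e₂ : ∀ m r s → r ℕ.+ m ℕ.+ (r ℕ.+ s) ≡ m ℕ.+ (2 ℕ.* r ℕ.+ s)
      e₂ = solve-∀
      shift : ∀ m → F (r ℕ.+ m) ≈ q ^ b * t r s m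
      shift m = trans
        (*-cong (*-cong (^-+ q b (m ℕ.* m ℕ.+ 2 ℕ.* (r ℕ.+ s) ℕ.* m) (e₁ m r s)) (reflexive (≡.cong o (ℕₚ.+-comm r m))))
                (*-cong (reflexive (p̂-+ r m)) (reflexive (≡.cong p (e₂ m r s)))))
        (solve 5 (λ a b c d e → a :* b :* c :* (d :* e) := a :* (b :* c :* d :* e)) refl _ _ _ _ _)

    weighted-even : ∀ r → sum (suc N) (λ n → weight 0 n * (p̂ n r * p (n ℕ.+ r))) ≈ q ^ (r ℕ.* r) * C
    weighted-even r = begin
      _                                 ≈⟨ sum-cong (suc N) (λ n → *-congˡ (*-congˡ (reflexive (≡.cong (λ k → p (n ℕ.+ k)) (≡.sym (ℕₚ.+-identityʳ r)))))) ⟩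
      _                                 ≈⟨ weighted-shift 0 r ⟩
      q ^ (r ℕ.* r ℕ.+ 0) * Y r 0       ≈⟨ *-cong (reflexive (≡.cong (q ^_) (ℕₚ.+-identityʳ (r ℕ.* r)))) (Y≈C r) ⟩
      q ^ (r ℕ.* r) * C                 ∎

    -- One step of the recurrence in i leads from `Y r 1` to `Y r 0`; its factor stays on the left
    -- because nothing is divided.
    weighted-odd : ∀ r → (1# + q ^ suc (2 ℕ.* r)) * sum (suc N) (λ n → weight 1 n * (p̂ n r * p (suc (n ℕ.+ r))))
                         ≈ q ^ (r ℕ.* r ℕ.+ 2 ℕ.* r) * C
    weighted-odd r = begin
      V * _                     ≈⟨ *-congˡ (sum-cong (suc N) (λ n → *-congˡ (*-congˡ (reflexive (≡.cong p (e n r)))))) ⟩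
      V * _                     ≈⟨ *-congˡ (weighted-shift 1 r) ⟩
      V * (B * Y r 1)           ≈⟨ solve 3 (λ a b c → a :* (b :* c) := b :* (a :* c)) refl _ _ _ ⟩
      B * (V * Y r 1)           ≈⟨ *-congˡ (*-congʳ (+-congˡ (reflexive (≡.cong (λ k → q ^ suc (2 ℕ.* k)) (≡.sym (ℕₚ.+-identityʳ r)))))) ⟩
      B * ((1# + q ^ suc (2 ℕ.* (r ℕ.+ 0))) * Y r 1)
                                ≈⟨ *-congˡ (Y-step r 0) ⟨
      B * Y r 0                 ≈⟨ *-congˡ (Y≈C r) ⟩
      B * C                     ∎
      where
      V = 1# + q ^ suc (2 ℕ.* r)
      B = q ^ (r ℕ.* r ℕ.+ 2 ℕ.* r)
      e : ∀ n r → suc (n ℕ.+ r) ≡ n ℕ.+ (r ℕ.+ 1)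
      e = solve-∀

    -- The interchange of summations behind Bailey's lemma. The expansion of `a n` is only asked for
    -- n ≤ N, where `suc N` terms in r suffice.
    weighted-swap : ∀ s (a : ℕ → Carrier) (F : ℕ → ℕ → Carrier) → (∀ n → n < suc N → a n ≈ sum (suc N) (F n)) →
      sum (suc N) (λ n → weight s n * a n) ≈ sum (suc N) (λ r → sum (suc N) (λ n → weight s n * F n r))
    weighted-swap s a F a≈ = trans
      (sum-cong< (suc N) (λ n n<N → trans (*-congˡ (a≈ n n<N)) (sum-*ˡ (suc N) (weight s n) (F n))))
      (sum-swap (suc N) (suc N) _)

    scaled : ∀ s x (F : ℕ → Carrier) →
      sum (suc N) (λ n → weight s n * (x * F n)) ≈ x * sum (suc N) (λ n → weight s n * F n)
    scaled s x F = trans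
      (sum-cong (suc N) λ n → solve 3 (λ a b c → a :* (b :* c) := b :* (a :* c)) refl _ _ _)
      (sym (sum-*ˡ (suc N) x _))

    S : ℕ → Carrier
    S s = sum (suc N) (λ n → weight s n * p n)

    -- Sums over all integers folded as before: the second exponent is the first one, r(4r+1),
    -- r(4r+3) or r(2r+1), evaluated at -(r+1).
    S₀-term S₁-term θ : ℕ → Carrier
    S₀-term r = q ^ (4 ℕ.* (r ℕ.* r) ℕ.+ r) + q ^ (4 ℕ.* (r ℕ.* r) ℕ.+ (7 ℕ.* r ℕ.+ 3))
    S₁-term r = q ^ (4 ℕ.* (r ℕ.* r) ℕ.+ 3 ℕ.* r) + q ^ (4 ℕ.* (r ℕ.* r) ℕ.+ (5 ℕ.* r ℕ.+ 1))
    θ       r = q ^ (2 ℕ.* (r ℕ.* r) ℕ.+ r) + q ^ (2 ℕ.* (r ℕ.* r) ℕ.+ (3 ℕ.* r ℕ.+ 1))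

    S₀≈ : S 0 ≈ C * sum (suc N) S₀-term
    S₀≈ = trans (weighted-swap 0 p even-term (λ n → p≈even-sum n))
            (trans (sum-cong (suc N) inner) (sym (sum-*ˡ (suc N) C _)))
      where
      e₁ : ∀ k r → 2 ℕ.* r ℕ.+ (k ℕ.+ r ℕ.* r) ≡ (k ℕ.+ r) ℕ.+ (r ℕ.* r ℕ.+ r)
      e₁ = solve-∀
      e₂ : ∀ r → 3 ℕ.* (r ℕ.* r) ℕ.+ (r ℕ.* r ℕ.+ r) ≡ 4 ℕ.* (r ℕ.* r) ℕ.+ r
      e₂ = solve-∀
      e₃ : ∀ r → 4 ℕ.* (suc r ℕ.* suc r) ≡ 4 ℕ.* (r ℕ.* r) ℕ.+ (7 ℕ.* r ℕ.+ 3) ℕ.+ suc r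
      e₃ = solve-∀
      e₄ : ∀ k r → k ℕ.+ suc r ℕ.* suc r ℕ.+ suc r ≡ (k ℕ.+ suc r) ℕ.+ suc r ℕ.* suc r
      e₄ = solve-∀
      e₅ : ∀ r → 3 ℕ.* r ℕ.+ r ≡ 4 ℕ.* r
      e₅ = solve-∀
      exp₁ : ∀ r → 4 ℕ.* (r ℕ.* r) ℕ.+ r ≡ 2 ℕ.* r ℕ.+ (κ r ℕ.+ r ℕ.* r)
      exp₁ r = ≡.sym (≡.trans (e₁ (κ r) r) (≡.trans (≡.cong (ℕ._+ (r ℕ.* r ℕ.+ r)) (κ+r r)) (e₂ r)))
      exp₂ : ∀ r → 4 ℕ.* (r ℕ.* r) ℕ.+ (7 ℕ.* r ℕ.+ 3) ≡ κ (suc r) ℕ.+ suc r ℕ.* suc r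
      -- `κ` is accessible without subtraction only as `κ (suc r) + suc r`, so `suc r` is added on
      -- both sides.
      exp₂ r = ℕₚ.+-cancelʳ-≡ (suc r) _ _ (≡.sym (≡.trans (e₄ (κ (suc r)) r)
        (≡.trans (≡.cong (ℕ._+ suc r ℕ.* suc r) (κ+r (suc r))) (≡.trans (e₅ (suc r ℕ.* suc r)) (e₃ r)))))
      inner : ∀ r → sum (suc N) (λ n → weight 0 n * even-term n r) ≈ C * S₀-term r
      inner r = begin
        sum (suc N) (λ n → weight 0 n * even-term n r)
          ≈⟨ sum-cong (suc N) (λ n → distribˡ _ _ _) ⟩
        sum (suc N) (λ n → weight 0 n * (z * h n r) + weight 0 n * h n (suc r))
          ≈⟨ sum-+ (suc N) _ _ ⟩
        sum (suc N) (λ n → weight 0 n * (z * h n r)) + sum (suc N) (λ n → weight 0 n * h n (suc r))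
          ≈⟨ +-cong (trans (scaled 0 z _) (*-congˡ (trans (scaled 0 (q ^ κ r) _) (*-congˡ (weighted-even r)))))
                    (trans (scaled 0 (q ^ κ (suc r)) _) (*-congˡ (weighted-even (suc r)))) ⟩
        z * (q ^ κ r * (q ^ (r ℕ.* r) * C)) + q ^ κ (suc r) * (q ^ (suc r ℕ.* suc r) * C)
          ≈⟨ solve 6 (λ a b c d e f → a :* (b :* (c :* f)) :+ d :* (e :* f) := f :* (a :* (b :* c) :+ d :* e)) refl _ _ _ _ _ _ ⟩
        C * (z * (q ^ κ r * q ^ (r ℕ.* r)) + q ^ κ (suc r) * q ^ (suc r ℕ.* suc r))
          ≈⟨ *-congˡ (+-cong
               (trans (^-+ q (2 ℕ.* r) (κ r ℕ.+ r ℕ.* r) (exp₁ r)) (*-congˡ (^-homo-* q (κ r) (r ℕ.* r))))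
               (^-+ q (κ (suc r)) (suc r ℕ.* suc r) (exp₂ r))) ⟨
        C * S₀-term r ∎
        where z = q ^ (2 ℕ.* r)

    S₁≈ : S 1 ≈ C * sum (suc N) S₁-term
    S₁≈ = trans (weighted-swap 1 p odd-term (λ n → p≈odd-sum n))
            (trans (sum-cong (suc N) inner) (sym (sum-*ˡ (suc N) C _)))
      where
      e₁ : ∀ k r → k ℕ.+ 2 ℕ.* r ℕ.+ (r ℕ.* r ℕ.+ 2 ℕ.* r) ≡ (k ℕ.+ r) ℕ.+ (r ℕ.* r ℕ.+ 3 ℕ.* r)
      e₁ = solve-∀
      e₂ : ∀ r → 3 ℕ.* (r ℕ.* r) ℕ.+ (r ℕ.* r ℕ.+ 3 ℕ.* r) ≡ 4 ℕ.* (r ℕ.* r) ℕ.+ 3 ℕ.* r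
      e₂ = solve-∀
      e₃ : ∀ r → 4 ℕ.* (r ℕ.* r) ℕ.+ (5 ℕ.* r ℕ.+ 1) ≡ suc (2 ℕ.* r) ℕ.+ (4 ℕ.* (r ℕ.* r) ℕ.+ 3 ℕ.* r)
      e₃ = solve-∀
      e₄ : ∀ r → suc (2 ℕ.* r) ℕ.+ suc (2 ℕ.* r) ≡ 2 ℕ.* r ℕ.+ 2 ℕ.* r ℕ.+ 2
      e₄ = solve-∀
      inner : ∀ r → sum (suc N) (λ n → weight 1 n * odd-term n r) ≈ C * S₁-term r
      inner r = begin
        sum (suc N) (λ n → weight 1 n * odd-term n r)
          ≈⟨ scaled 1 (A * z * (1# + z * z * Q)) _ ⟩
        -- In characteristic 2 the coefficient 1 + q^(4r+2) is the square of 1 + q^(2r+1). One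
        -- factor is used up by `weighted-odd`, the other produces the two exponents of `S₁-term`.
        A * z * (1# + z * z * Q) * W
          ≈⟨ *-congʳ (*-congˡ (+-congˡ vv)) ⟨
        A * z * (1# + v * v) * W
          ≈⟨ solve 4 (λ A z v W → A :* z :* (:1 :+ v :* v) :* W := A :* z :* (:1 :+ v) :* ((:1 :+ v) :* W)) refl A z v W ⟩
        A * z * (1# + v) * ((1# + v) * W)
          ≈⟨ *-congˡ (weighted-odd r) ⟩
        A * z * (1# + v) * (B * C)
          ≈⟨ solve 5 (λ A z v B C → A :* z :* (:1 :+ v) :* (B :* C) := C :* (A :* z :* B :+ v :* (A :* z :* B))) refl A z v B C ⟩
        C * (A * z * B + v * (A * z * B))
          ≈⟨ *-congˡ (+-cong azb (trans (^-+ q (suc (2 ℕ.* r)) (4 ℕ.* (r ℕ.* r) ℕ.+ 3 ℕ.* r) (e₃ r)) (*-congˡ azb))) ⟨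
        C * S₁-term r ∎
        where
        A = q ^ κ r
        z = q ^ (2 ℕ.* r)
        Q = q ^ 2
        v = q ^ suc (2 ℕ.* r)
        B = q ^ (r ℕ.* r ℕ.+ 2 ℕ.* r)
        W = sum (suc N) (λ n → weight 1 n * (p̂ n r * p (suc (n ℕ.+ r))))
        vv : v * v ≈ z * z * Q
        vv = trans (sym (^-homo-* q (suc (2 ℕ.* r)) (suc (2 ℕ.* r))))
               (trans (^-+ q (2 ℕ.* r ℕ.+ 2 ℕ.* r) 2 (e₄ r)) (*-congʳ (^-homo-* q (2 ℕ.* r) (2 ℕ.* r))))
        azb : q ^ (4 ℕ.* (r ℕ.* r) ℕ.+ 3 ℕ.* r) ≈ A * z * B
        azb = trans (^-+ q (κ r ℕ.+ 2 ℕ.* r) (r ℕ.* r ℕ.+ 2 ℕ.* r)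
                (≡.sym (≡.trans (e₁ (κ r) r) (≡.trans (≡.cong (ℕ._+ (r ℕ.* r ℕ.+ 3 ℕ.* r)) (κ+r r)) (e₂ r)))))
                (*-congʳ (^-homo-* q (κ r) (2 ℕ.* r)))

    C*θ≈1 : C * sum (suc N) θ ≈ 1#
    C*θ≈1 = begin
      C * sum (suc N) θ                               ≈⟨ sum-*ˡ (suc N) C θ ⟩
      sum (suc N) (λ r → C * θ r)                     ≈⟨ sum-cong (suc N) inner ⟨
      _                                               ≈⟨ weighted-swap 0 δ unit-term δ≈ ⟨
      sum (suc N) (λ n → weight 0 n * δ n)            ≈⟨ sum-head N _ (λ n → zeroʳ _) ⟩
      1# * 1# * 1#                                    ≈⟨ solve 0 (:1 :* :1 :* :1 := :1) refl ⟩
      1#                                              ∎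
      where
      δ : ℕ → Carrier
      δ zero    = 1#
      δ (suc _) = 0#
      δ≈ : ∀ n → n < suc N → δ n ≈ sum (suc N) (unit-term n)
      δ≈ zero    0<N = sym (unit-sum-zero 0<N)
      δ≈ (suc n) n<N = sym (unit-sum-suc n n<N)
      e₁ : ∀ k r → k ℕ.+ 2 ℕ.* r ℕ.+ r ℕ.* r ≡ (k ℕ.+ r) ℕ.+ (r ℕ.* r ℕ.+ r)
      e₁ = solve-∀
      e₂ : ∀ r → r ℕ.* r ℕ.+ (r ℕ.* r ℕ.+ r) ≡ 2 ℕ.* (r ℕ.* r) ℕ.+ r
      e₂ = solve-∀
      e₃ : ∀ k r → k ℕ.+ 2 ℕ.* r ℕ.+ suc r ℕ.* suc r ≡ (k ℕ.+ r) ℕ.+ (r ℕ.* r ℕ.+ (3 ℕ.* r ℕ.+ 1))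
      e₃ = solve-∀
      e₄ : ∀ r → r ℕ.* r ℕ.+ (r ℕ.* r ℕ.+ (3 ℕ.* r ℕ.+ 1)) ≡ 2 ℕ.* (r ℕ.* r) ℕ.+ (3 ℕ.* r ℕ.+ 1)
      e₄ = solve-∀
      inner : ∀ r → sum (suc N) (λ n → weight 0 n * unit-term n r) ≈ C * θ r
      inner r = begin
        sum (suc N) (λ n → weight 0 n * unit-term n r)
          ≈⟨ scaled 0 T _ ⟩
        T * sum (suc N) (λ n → weight 0 n * (p̂ n r * p (n ℕ.+ r) + p̂ n (suc r) * p (n ℕ.+ suc r)))
          ≈⟨ *-congˡ (trans (sum-cong (suc N) (λ n → distribˡ _ _ _)) (sum-+ (suc N) _ _)) ⟩
        _ ≈⟨ *-congˡ (+-cong (weighted-even r) (weighted-even (suc r))) ⟩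
        T * (q ^ (r ℕ.* r) * C + q ^ (suc r ℕ.* suc r) * C)
          ≈⟨ solve 4 (λ T a b C → T :* (a :* C :+ b :* C) := C :* (T :* a :+ T :* b)) refl _ _ _ _ ⟩
        C * (T * q ^ (r ℕ.* r) + T * q ^ (suc r ℕ.* suc r))
          ≈⟨ *-congˡ (+-cong
               (^-+ q (τ r ℕ.+ 2 ℕ.* r) (r ℕ.* r) (≡.sym (≡.trans (e₁ (τ r) r) (≡.trans (≡.cong (ℕ._+ (r ℕ.* r ℕ.+ r)) (τ+r r)) (e₂ r)))))
               (^-+ q (τ r ℕ.+ 2 ℕ.* r) (suc r ℕ.* suc r) (≡.sym (≡.trans (e₃ (τ r) r) (≡.trans (≡.cong (ℕ._+ (r ℕ.* r ℕ.+ (3 ℕ.* r ℕ.+ 1))) (τ+r r)) (e₄ r)))))) ⟨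
        C * θ r ∎
        where T = q ^ τ (suc r)

    -- The exponents of θ are the triangular numbers: the even ones are twice the exponents of S₀-term, the odd
    -- ones are twice the exponents of S₁-term, plus one.
    S₀²+qS₁² : S 0 * S 0 + q * (S 1 * S 1) ≈ C
    S₀²+qS₁² = begin
      S 0 * S 0 + q * (S 1 * S 1)
        ≈⟨ +-cong (*-cong S₀≈ S₀≈) (*-congˡ (*-cong S₁≈ S₁≈)) ⟩
      C * A * (C * A) + q * (C * B * (C * B))
        ≈⟨ solve 4 (λ C A q B → C :* A :* (C :* A) :+ q :* (C :* B :* (C :* B)) := C :* (C :* (A :* A :+ q :* (B :* B)))) refl C A q B ⟩
      C * (C * (A * A + q * (B * B)))
        ≈⟨ *-congˡ (*-congˡ squares) ⟩
      C * (C * sum (suc N) θ)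
        ≈⟨ *-congˡ C*θ≈1 ⟩
      C * 1#
        ≈⟨ *-identityʳ C ⟩
      C ∎
      where
      A = sum (suc N) S₀-term
      B = sum (suc N) S₁-term
      e₁ : ∀ r → 2 ℕ.* (2 ℕ.* r ℕ.* (2 ℕ.* r)) ℕ.+ 2 ℕ.* r
             ≡ (4 ℕ.* (r ℕ.* r) ℕ.+ r) ℕ.+ (4 ℕ.* (r ℕ.* r) ℕ.+ r)
      e₁ = solve-∀
      e₂ : ∀ r → 2 ℕ.* (2 ℕ.* r ℕ.* (2 ℕ.* r)) ℕ.+ (3 ℕ.* (2 ℕ.* r) ℕ.+ 1)
             ≡ 1 ℕ.+ ((4 ℕ.* (r ℕ.* r) ℕ.+ 3 ℕ.* r) ℕ.+ (4 ℕ.* (r ℕ.* r) ℕ.+ 3 ℕ.* r))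
      e₂ = solve-∀
      e₃ : ∀ r → 2 ℕ.* (suc (2 ℕ.* r) ℕ.* suc (2 ℕ.* r)) ℕ.+ suc (2 ℕ.* r)
             ≡ 1 ℕ.+ ((4 ℕ.* (r ℕ.* r) ℕ.+ (5 ℕ.* r ℕ.+ 1)) ℕ.+ (4 ℕ.* (r ℕ.* r) ℕ.+ (5 ℕ.* r ℕ.+ 1)))
      e₃ = solve-∀
      e₄ : ∀ r → 2 ℕ.* (suc (2 ℕ.* r) ℕ.* suc (2 ℕ.* r)) ℕ.+ (3 ℕ.* suc (2 ℕ.* r) ℕ.+ 1)
             ≡ (4 ℕ.* (r ℕ.* r) ℕ.+ (7 ℕ.* r ℕ.+ 3)) ℕ.+ (4 ℕ.* (r ℕ.* r) ℕ.+ (7 ℕ.* r ℕ.+ 3))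
      e₄ = solve-∀
      q² : ∀ {k} a → k ≡ a ℕ.+ a → q ^ k ≈ q ^ a * q ^ a
      q² a = ^-+ q a a
      qq² : ∀ {k} a → k ≡ 1 ℕ.+ (a ℕ.+ a) → q ^ k ≈ q * (q ^ a * q ^ a)
      qq² a ≡.refl = *-congˡ (^-homo-* q a a)
      dissect : ∀ r → S₀-term r * S₀-term r + q * (S₁-term r * S₁-term r) ≈ θ (2 ℕ.* r) + θ (suc (2 ℕ.* r))
      dissect r = sym (trans
        (+-cong (+-cong (q² (4 ℕ.* (r ℕ.* r) ℕ.+ r) (e₁ r)) (qq² (4 ℕ.* (r ℕ.* r) ℕ.+ 3 ℕ.* r) (e₂ r)))
                (+-cong (qq² (4 ℕ.* (r ℕ.* r) ℕ.+ (5 ℕ.* r ℕ.+ 1)) (e₃ r)) (q² (4 ℕ.* (r ℕ.* r) ℕ.+ (7 ℕ.* r ℕ.+ 3)) (e₄ r))))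
        (solve 5 (λ a b c d q → a :* a :+ q :* (b :* b) :+ (q :* (c :* c) :+ d :* d) :=
           (a :+ d) :* (a :+ d) :+ q :* ((b :+ c) :* (b :+ c))) refl _ _ _ _ _))
      θ-zero : ∀ r → suc N ≤ r → θ r ≈ 0#
      θ-zero r N<r = trans (+-cong (qᵏ≈0 (ℕₚ.≤-trans N≤r (ℕₚ.m≤n+m r (2 ℕ.* (r ℕ.* r)))))
                                   (qᵏ≈0 (ℕₚ.≤-trans N≤r (ℕₚ.≤-trans (ℕₚ.m≤n*m r 3) (ℕₚ.≤-trans (ℕₚ.m≤m+n _ 1) (ℕₚ.m≤n+m _ (2 ℕ.* (r ℕ.* r))))))))
                           (+-identityˡ 0#)
        where N≤r = ℕₚ.<⇒≤ N<r
      squares : A * A + q * (B * B) ≈ sum (suc N) θ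
      squares = begin
        A * A + q * (B * B)
          ≈⟨ +-cong (sum-square (suc N) S₀-term) (trans (*-congˡ (sum-square (suc N) S₁-term)) (sum-*ˡ (suc N) q _)) ⟩
        _ ≈⟨ sum-+ (suc N) _ _ ⟨
        sum (suc N) (λ r → S₀-term r * S₀-term r + q * (S₁-term r * S₁-term r))
          ≈⟨ sum-cong (suc N) dissect ⟩
        sum (suc N) (λ r → θ (2 ℕ.* r) + θ (suc (2 ℕ.* r)))
          ≈⟨ sum-pairs (suc N) θ ⟩
        sum (2 ℕ.* suc N) θ
          ≈⟨ sum-extend θ (ℕₚ.m≤n*m (suc N) 2) θ-zero ⟩
        sum (suc N) θ ∎

    -- Euler's product and its relation to C.

    E : ℕ → Carrier
    E zero    = 1#
    E (suc k) = E k * (1# + q ^ suc k)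

    E-stable : ∀ k → E (k ℕ.+ N) ≈ E N
    E-stable zero    = refl
    E-stable (suc k) = trans
      (*-cong (E-stable k) (1+qᵏ≈1 (ℕₚ.≤-trans (ℕₚ.m≤n+m N k) (ℕₚ.n≤1+n _)))) (*-identityʳ _)

    -- By Frobenius, (q;q)_k² is (q²;q²)_k.
    E²*p : ∀ k → E k * E k * p k ≈ 1#
    E²*p zero    = trans (*-congˡ p₀) (solve 0 (:1 :* :1 :* :1 := :1) refl)
    E²*p (suc k) = begin
      E k * (1# + x) * (E k * (1# + x)) * p (suc k)
        ≈⟨ solve 3 (λ e x y → e :* (:1 :+ x) :* (e :* (:1 :+ x)) :* y := e :* e :* ((:1 :+ x :* x) :* y)) refl _ _ _ ⟩
      E k * E k * ((1# + x * x) * p (suc k))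
        ≈⟨ *-congˡ (*-congʳ (+-congˡ (^-+ q (suc k) (suc k) (e k)))) ⟨
      E k * E k * ((1# + q ^ (2 ℕ.* suc k)) * p (suc k))
        ≈⟨ *-congˡ (p-step k) ⟨
      E k * E k * p k
        ≈⟨ E²*p k ⟩
      1# ∎
      where
      x = q ^ suc k
      e : ∀ k → 2 ℕ.* suc k ≡ suc k ℕ.+ suc k
      e = solve-∀

    -- The odd exponents up to 2k form `o k`; the even ones form (q²;q²)_k, a square.
    E-double : ∀ k → E (2 ℕ.* k) ≈ o k * (E k * E k)
    E-double zero    = solve 0 (:1 := :1 :* (:1 :* :1)) refl
    E-double (suc k) rewrite ℕₚ.+-suc k (k ℕ.+ 0) = begin
      E (2 ℕ.* k) * (1# + y) * (1# + q ^ suc (suc (2 ℕ.* k)))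
        ≈⟨ *-cong (*-congʳ (E-double k)) (+-congˡ (^-+ q (suc k) (suc k) (e k))) ⟩
      o k * (E k * E k) * (1# + y) * (1# + x * x)
        ≈⟨ solve 4 (λ o e x y → o :* (e :* e) :* (:1 :+ y) :* (:1 :+ x :* x) :=
             o :* (:1 :+ y) :* (e :* (:1 :+ x) :* (e :* (:1 :+ x)))) refl _ _ _ _ ⟩
      o k * (1# + y) * (E k * (1# + x) * (E k * (1# + x))) ∎
      where
      x = q ^ suc k
      y = q ^ suc (2 ℕ.* k)
      e : ∀ k → suc (suc (2 ℕ.* k)) ≡ suc k ℕ.+ suc k
      e = solve-∀

    -- Since `E (2 * N)` has stabilised to `E N`, doubling makes `o N` the inverse of `E N`, while
    -- `p N` is the inverse of its square.
    C*E³≈1 : C * (E N * E N * E N) ≈ 1#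
    C*E³≈1 = begin
      o N * p N * (ε * ε * ε)                  ≈⟨ solve 3 (λ o p e → o :* p :* (e :* e :* e) := e :* e :* p :* (o :* e)) refl _ _ _ ⟩
      ε * ε * p N * (o N * ε)                  ≈⟨ *-cong (E²*p N) (sym (*-identityʳ _)) ⟩
      1# * (o N * ε * 1#)                      ≈⟨ *-congˡ (*-congˡ (E²*p N)) ⟨
      1# * (o N * ε * (ε * ε * p N))           ≈⟨ solve 3 (λ o p e → :1 :* (o :* e :* (e :* e :* p)) := o :* (e :* e) :* (e :* p)) refl _ _ _ ⟩
      o N * (ε * ε) * (ε * p N)                ≈⟨ *-congʳ (E-double N) ⟨
      E (2 ℕ.* N) * (ε * p N)                  ≈⟨ *-congʳ (trans (reflexive (≡.cong (λ k → E (N ℕ.+ k)) (ℕₚ.+-identityʳ N))) (E-stable N)) ⟩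
      ε * (ε * p N)                            ≈⟨ *-assoc _ _ _ ⟨
      ε * ε * p N                              ≈⟨ E²*p N ⟩
      1#                                       ∎
      where ε = E N

-- Congruence of integers modulo 2.

infix 4 _∼_

-- The same relation as _≡₂_, as a record so that its arguments can be inferred.
record _∼_ (a b : ℤ) : Set where
  constructor half
  field
    quotient : ℤ
    equality : a ℤ.- b ≡ quotient ℤ.* + 2

∼⇒≡₂ : ∀ a b → a ∼ b → a ≡₂ b
∼⇒≡₂ a b (half k eq) = Signed.∣⇒∣ᵤ (Signed.divides k eq)

∼-reflexive : ∀ {a b} → a ≡ b → a ∼ b
∼-reflexive {a} ≡.refl = half (+ 0) (ℤₚ.+-inverseʳ a)

∼-refl : ∀ {a} → a ∼ a
∼-refl = ∼-reflexive ≡.refl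

∼-sym : ∀ {a b} → a ∼ b → b ∼ a
∼-sym {a} {b} (half k eq) = half (ℤ.- k) (≡.trans (e₁ a b) (≡.trans (≡.cong ℤ.-_ eq) (e₂ k)))
  where
  e₁ : ∀ a b → b ℤ.- a ≡ ℤ.- (a ℤ.- b)
  e₁ = ℤ-Solver.solve-∀
  e₂ : ∀ k → ℤ.- (k ℤ.* + 2) ≡ ℤ.- k ℤ.* + 2
  e₂ = ℤ-Solver.solve-∀

∼-trans : ∀ {a b c} → a ∼ b → b ∼ c → a ∼ c
∼-trans {a} {b} {c} (half k eq) (half l eq′) =
  half (k ℤ.+ l) (≡.trans (e₁ a b c) (≡.trans (≡.cong₂ ℤ._+_ eq eq′) (e₂ k l)))
  where
  e₁ : ∀ a b c → a ℤ.- c ≡ (a ℤ.- b) ℤ.+ (b ℤ.- c)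
  e₁ = ℤ-Solver.solve-∀
  e₂ : ∀ k l → k ℤ.* + 2 ℤ.+ l ℤ.* + 2 ≡ (k ℤ.+ l) ℤ.* + 2
  e₂ = ℤ-Solver.solve-∀

+-∼ : ∀ {a b c d} → a ∼ b → c ∼ d → a ℤ.+ c ∼ b ℤ.+ d
+-∼ {a} {b} {c} {d} (half k eq) (half l eq′) =
  half (k ℤ.+ l) (≡.trans (e₁ a b c d) (≡.trans (≡.cong₂ ℤ._+_ eq eq′) (e₂ k l)))
  where
  e₁ : ∀ a b c d → a ℤ.+ c ℤ.- (b ℤ.+ d) ≡ (a ℤ.- b) ℤ.+ (c ℤ.- d)
  e₁ = ℤ-Solver.solve-∀
  e₂ : ∀ k l → k ℤ.* + 2 ℤ.+ l ℤ.* + 2 ≡ (k ℤ.+ l) ℤ.* + 2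
  e₂ = ℤ-Solver.solve-∀

*-∼ : ∀ {a b c d} → a ∼ b → c ∼ d → a ℤ.* c ∼ b ℤ.* d
*-∼ {a} {b} {c} {d} (half k eq) (half l eq′) =
  half (k ℤ.* c ℤ.+ b ℤ.* l) (≡.trans (e₁ a b c d)
    (≡.trans (≡.cong₂ (λ x y → x ℤ.* c ℤ.+ b ℤ.* y) eq eq′) (e₂ k l b c)))
  where
  e₁ : ∀ a b c d → a ℤ.* c ℤ.- b ℤ.* d ≡ (a ℤ.- b) ℤ.* c ℤ.+ b ℤ.* (c ℤ.- d)
  e₁ = ℤ-Solver.solve-∀
  e₂ : ∀ k l b c → k ℤ.* + 2 ℤ.* c ℤ.+ b ℤ.* (l ℤ.* + 2) ≡ (k ℤ.* c ℤ.+ b ℤ.* l) ℤ.* + 2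
  e₂ = ℤ-Solver.solve-∀

-‿∼ : ∀ {a b} → a ∼ b → ℤ.- a ∼ ℤ.- b
-‿∼ {a} {b} (half k eq) = half (ℤ.- k) (≡.trans (e₁ a b) (≡.trans (≡.cong ℤ.-_ eq) (e₂ k)))
  where
  e₁ : ∀ a b → ℤ.- a ℤ.- (ℤ.- b) ≡ ℤ.- (a ℤ.- b)
  e₁ = ℤ-Solver.solve-∀
  e₂ : ∀ k → ℤ.- (k ℤ.* + 2) ≡ ℤ.- k ℤ.* + 2
  e₂ = ℤ-Solver.solve-∀

-a∼a : ∀ a → ℤ.- a ∼ a
-a∼a a = half (ℤ.- a) (e a)
  where
  e : ∀ a → ℤ.- a ℤ.- a ≡ ℤ.- a ℤ.* + 2
  e = ℤ-Solver.solve-∀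

a+b+a∼b : ∀ a b → a ℤ.+ b ℤ.+ a ∼ b
a+b+a∼b a b = half a (e a b)
  where
  e : ∀ a b → a ℤ.+ b ℤ.+ a ℤ.- b ≡ a ℤ.* + 2
  e = ℤ-Solver.solve-∀

a*a∼a : ∀ a → a ℤ.* a ∼ a
a*a∼a (+ n)      = nonneg n
  where
  e₁ : ∀ a → (+ 2 ℤ.+ a) ℤ.* (+ 2 ℤ.+ a) ℤ.- a ℤ.* a ≡ (+ 2 ℤ.* a ℤ.+ + 2) ℤ.* + 2
  e₁ = ℤ-Solver.solve-∀
  e₂ : ∀ a → a ℤ.- (+ 2 ℤ.+ a) ≡ ℤ.- + 1 ℤ.* + 2
  e₂ = ℤ-Solver.solve-∀
  nonneg : ∀ n → + n ℤ.* + n ∼ + n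
  nonneg zero          = ∼-refl
  nonneg (suc zero)    = ∼-refl
  nonneg (suc (suc n)) = ∼-trans (half (+ 2 ℤ.* + n ℤ.+ + 2) (e₁ (+ n)))
                           (∼-trans (nonneg n) (half (ℤ.- + 1) (e₂ (+ n))))
a*a∼a ℤ.-[1+ n ] = ∼-trans (a*a∼a (+ suc n)) (∼-sym (-a∼a (+ suc n)))

-- Finite sums and Cauchy products of integer series.

sumTo-∼ : ∀ n {F G} → (∀ k → k < n → F k ∼ G k) → sumTo n F ∼ sumTo n G
sumTo-∼ zero    F∼G = ∼-refl
sumTo-∼ (suc n) F∼G = +-∼ (sumTo-∼ n λ k k<n → F∼G k (ℕₚ.m<n⇒m<1+n k<n)) (F∼G n ℕₚ.≤-refl)

sumTo-cong : ∀ n {F G} → (∀ k → k < n → F k ≡ G k) → sumTo n F ≡ sumTo n G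
sumTo-cong zero    F≡G = ≡.refl
sumTo-cong (suc n) F≡G = ≡.cong₂ ℤ._+_ (sumTo-cong n λ k k<n → F≡G k (ℕₚ.m<n⇒m<1+n k<n)) (F≡G n ℕₚ.≤-refl)

sumTo-0 : ∀ n → sumTo n (λ _ → + 0) ≡ + 0
sumTo-0 zero    = ≡.refl
sumTo-0 (suc n) = ≡.cong (ℤ._+ + 0) (sumTo-0 n)

sumTo-zero : ∀ n {F} → (∀ k → k < n → F k ∼ + 0) → sumTo n F ∼ + 0
sumTo-zero n F∼0 = ∼-trans (sumTo-∼ n F∼0) (∼-reflexive (sumTo-0 n))

sumTo-front : ∀ n F → sumTo (suc n) F ≡ F 0 ℤ.+ sumTo n (λ k → F (suc k))
sumTo-front zero    F = ℤₚ.+-comm (+ 0) (F 0)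
sumTo-front (suc n) F = ≡.trans (≡.cong (ℤ._+ F (suc n)) (sumTo-front n F)) (ℤₚ.+-assoc (F 0) _ _)

sumTo-extend : ∀ {m n} F → m ≤ n → (∀ k → m ≤ k → F k ∼ + 0) → sumTo n F ∼ sumTo m F
sumTo-extend {m} {n} F m≤n F∼0 with ℕₚ.m≤n⇒m<n∨m≡n m≤n
... | inj₂ ≡.refl = ∼-refl
sumTo-extend {m} {suc n} F _ F∼0 | inj₁ (s≤s m≤n) =
  ∼-trans (+-∼ (sumTo-extend F m≤n F∼0) (F∼0 n m≤n)) (∼-reflexive (ℤₚ.+-identityʳ _))

tail : Series → Series
tail f n = f (suc n)

⊛-front : ∀ f g n → (f ⊛ g) (suc n) ≡ f 0 ℤ.* g (suc n) ℤ.+ (tail f ⊛ g) n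
⊛-front f g n = sumTo-front (suc n) (λ k → f k ℤ.* g (suc n ℕ.∸ k))

⊛-back : ∀ f g n → (f ⊛ g) (suc n) ≡ (f ⊛ tail g) n ℤ.+ f (suc n) ℤ.* g 0
⊛-back f g n = ≡.cong₂ ℤ._+_
  (sumTo-cong (suc n) λ { k (s≤s k≤n) → ≡.cong (λ l → f k ℤ.* g l) (ℕₚ.+-∸-assoc 1 k≤n) })
  (≡.cong (λ l → f (suc n) ℤ.* g l) (ℕₚ.n∸n≡0 n))

⊛-cong : ∀ {f f′ g g′} → (∀ n → f n ≡ f′ n) → (∀ n → g n ≡ g′ n) → ∀ n → (f ⊛ g) n ≡ (f′ ⊛ g′) n
⊛-cong f≡ g≡ n = sumTo-cong (suc n) λ k _ → ≡.cong₂ ℤ._*_ (f≡ k) (g≡ (n ℕ.∸ k))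

⊛-comm : ∀ f g n → (f ⊛ g) n ≡ (g ⊛ f) n
⊛-comm f g zero    = ≡.cong (ℤ._+_ (+ 0)) (ℤₚ.*-comm (f 0) (g 0))
⊛-comm f g (suc n) = ≡.trans (⊛-front f g n) (≡.trans
  (≡.trans (ℤₚ.+-comm (f 0 ℤ.* g (suc n)) _)
    (≡.cong₂ ℤ._+_ (⊛-comm (tail f) g n) (ℤₚ.*-comm (f 0) (g (suc n)))))
  (≡.sym (⊛-back g f n)))

⊛-distribʳ-⊕ : ∀ h f g n → ((f ⊕ g) ⊛ h) n ≡ (f ⊛ h ⊕ g ⊛ h) n
⊛-distribʳ-⊕ h f g zero    = e (f 0) (g 0) (h 0)
  where
  e : ∀ a b c → + 0 ℤ.+ (a ℤ.+ b) ℤ.* c ≡ + 0 ℤ.+ a ℤ.* c ℤ.+ (+ 0 ℤ.+ b ℤ.* c)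
  e = ℤ-Solver.solve-∀
⊛-distribʳ-⊕ h f g (suc n) = ≡.trans (⊛-front (f ⊕ g) h n) (≡.trans
  (≡.trans (≡.cong (ℤ._+_ ((f 0 ℤ.+ g 0) ℤ.* h (suc n))) (⊛-distribʳ-⊕ h (tail f) (tail g) n))
    (e (f 0) (g 0) (h (suc n)) ((tail f ⊛ h) n) ((tail g ⊛ h) n)))
  (≡.sym (≡.cong₂ ℤ._+_ (⊛-front f h n) (⊛-front g h n))))
  where
  e : ∀ a b c x y → (a ℤ.+ b) ℤ.* c ℤ.+ (x ℤ.+ y) ≡ (a ℤ.* c ℤ.+ x) ℤ.+ (b ℤ.* c ℤ.+ y)
  e = ℤ-Solver.solve-∀

⊛-scale : ∀ a g h n → ((λ k → a ℤ.* g k) ⊛ h) n ≡ a ℤ.* (g ⊛ h) n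
⊛-scale a g h zero    = e a (g 0) (h 0)
  where
  e : ∀ a b c → + 0 ℤ.+ a ℤ.* b ℤ.* c ≡ a ℤ.* (+ 0 ℤ.+ b ℤ.* c)
  e = ℤ-Solver.solve-∀
⊛-scale a g h (suc n) = ≡.trans (⊛-front (λ k → a ℤ.* g k) h n) (≡.trans
  (≡.trans (≡.cong (ℤ._+_ (a ℤ.* g 0 ℤ.* h (suc n))) (⊛-scale a (tail g) h n))
    (e a (g 0) (h (suc n)) ((tail g ⊛ h) n)))
  (≡.cong (a ℤ.*_) (≡.sym (⊛-front g h n))))
  where
  e : ∀ a b c x → a ℤ.* b ℤ.* c ℤ.+ a ℤ.* x ≡ a ℤ.* (b ℤ.* c ℤ.+ x)
  e = ℤ-Solver.solve-∀

⊛-assoc : ∀ f g h n → ((f ⊛ g) ⊛ h) n ≡ (f ⊛ (g ⊛ h)) n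
⊛-assoc f g h zero    = e (f 0) (g 0) (h 0)
  where
  e : ∀ a b c → + 0 ℤ.+ (+ 0 ℤ.+ a ℤ.* b) ℤ.* c ≡ + 0 ℤ.+ a ℤ.* (+ 0 ℤ.+ b ℤ.* c)
  e = ℤ-Solver.solve-∀
⊛-assoc f g h (suc n) = ≡.trans (⊛-front (f ⊛ g) h n) (≡.trans
  (≡.trans (≡.cong (ℤ._+_ ((+ 0 ℤ.+ f 0 ℤ.* g 0) ℤ.* h (suc n))) tail-part)
    (≡.trans (e (f 0) (g 0) (h (suc n)) ((tail g ⊛ h) n) ((tail f ⊛ (g ⊛ h)) n))
      (≡.cong (λ x → f 0 ℤ.* x ℤ.+ (tail f ⊛ (g ⊛ h)) n) (≡.sym (⊛-front g h n)))))
  (≡.sym (⊛-front f (g ⊛ h) n)))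
  where
  e : ∀ a b c x y → (+ 0 ℤ.+ a ℤ.* b) ℤ.* c ℤ.+ (a ℤ.* x ℤ.+ y) ≡ a ℤ.* (b ℤ.* c ℤ.+ x) ℤ.+ y
  e = ℤ-Solver.solve-∀
  tail-part : (tail (f ⊛ g) ⊛ h) n ≡ f 0 ℤ.* (tail g ⊛ h) n ℤ.+ (tail f ⊛ (g ⊛ h)) n
  tail-part = ≡.trans (⊛-cong {g = h} (⊛-front f g) (λ _ → ≡.refl) n)
    (≡.trans (⊛-distribʳ-⊕ h (λ k → f 0 ℤ.* tail g k) (tail f ⊛ g) n)
      (≡.cong₂ ℤ._+_ (⊛-scale (f 0) (tail g) h n) (⊛-assoc (tail f) g h n)))

0⊛ : ∀ f n → ((λ _ → + 0) ⊛ f) n ≡ + 0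
0⊛ f n = sumTo-0 (suc n)

⊛-identityˡ : ∀ f n → (𝟙 ⊛ f) n ≡ f n
⊛-identityˡ f zero    = ≡.trans (ℤₚ.+-identityˡ _) (ℤₚ.*-identityˡ (f 0))
⊛-identityˡ f (suc n) = ≡.trans (⊛-front 𝟙 f n)
  (≡.trans (≡.cong₂ ℤ._+_ (ℤₚ.*-identityˡ (f (suc n))) (0⊛ f n)) (ℤₚ.+-identityʳ _))

-- Frobenius f(q)² = f(q²) coefficient by coefficient. The induction strips the two ends of the
-- convolution until f(0)² or 2 f(0) f(1) is left.
square-even : ∀ f n → (f ⊛ f) (2 ℕ.* n) ∼ f n
square-odd  : ∀ f n → (f ⊛ f) (suc (2 ℕ.* n)) ∼ + 0

-- The two outer terms of the convolution agree, and the rest is the square of tail f.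
square-tail : ∀ f n → (f ⊛ f) (suc (suc n)) ∼ (tail f ⊛ tail f) n
square-tail f n = ∼-trans (∼-reflexive (≡.trans (⊛-front f f (suc n))
    (≡.trans (≡.cong (ℤ._+_ (f 0 ℤ.* f (suc (suc n)))) (⊛-back (tail f) f n))
      (≡.trans (≡.sym (ℤₚ.+-assoc (f 0 ℤ.* f (suc (suc n))) _ _))
        (≡.cong (ℤ._+_ (f 0 ℤ.* f (suc (suc n)) ℤ.+ (tail f ⊛ tail f) n)) (ℤₚ.*-comm (f (suc (suc n))) (f 0)))))))
  (a+b+a∼b (f 0 ℤ.* f (suc (suc n))) _)

square-even f zero    = ∼-trans (∼-reflexive (ℤₚ.+-identityˡ _)) (a*a∼a (f 0))
square-even f (suc n) rewrite ℕₚ.+-suc n (n ℕ.+ 0) =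
  ∼-trans (square-tail f (2 ℕ.* n)) (square-even (tail f) n)

square-odd f zero    = half (f 0 ℤ.* f 1) (e (f 0) (f 1))
  where
  e : ∀ a b → + 0 ℤ.+ a ℤ.* b ℤ.+ b ℤ.* a ℤ.- + 0 ≡ a ℤ.* b ℤ.* + 2
  e = ℤ-Solver.solve-∀
square-odd f (suc n) rewrite ℕₚ.+-suc n (n ℕ.+ 0) =
  ∼-trans (square-tail f (suc (2 ℕ.* n))) (square-odd (tail f) n)

-- The ring of series modulo 2 and q^N.

infix 4 _≈[_]_

record _≈[_]_ (f : Series) (N : ℕ) (g : Series) : Set where
  constructor trunc
  field
    at : ∀ n → n < N → f n ∼ g n
open _≈[_]_ public

exact : ∀ {f g N} → (∀ n → f n ≡ g n) → f ≈[ N ] g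
exact f≡g = trunc λ n _ → ∼-reflexive (f≡g n)

weaken : ∀ {f g M N} → N ≤ M → f ≈[ M ] g → f ≈[ N ] g
weaken N≤M f≈g = trunc λ n n<N → at f≈g n (ℕₚ.<-≤-trans n<N N≤M)

-- The elements are still the integer series and only the equality is coarser, so the series of the
-- statement are elements as they stand, for every N at once.
truncated : ℕ → CommutativeRing 0ℓ 0ℓ
truncated N = record
  { Carrier = Series ; _≈_ = _≈[ N ]_ ; _+_ = _⊕_ ; _*_ = _⊛_ ; -_ = λ f n → ℤ.- f n ; 0# = λ _ → + 0 ; 1# = 𝟙
  ; isCommutativeRing = record
    { isRing = record
      { +-isAbelianGroup = record
        { isGroup = record
          { isMonoid = record
            { isSemigroup = record
              { isMagma = record
                { isEquivalence = record
                  { refl  = exact λ _ → ≡.refl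
                  ; sym   = λ f≈g → trunc λ n n<N → ∼-sym (at f≈g n n<N)
                  ; trans = λ f≈g g≈h → trunc λ n n<N → ∼-trans (at f≈g n n<N) (at g≈h n n<N)
                  }
                ; ∙-cong = λ f≈ g≈ → trunc λ n n<N → +-∼ (at f≈ n n<N) (at g≈ n n<N)
                }
              ; assoc = λ f g h → exact λ n → ℤₚ.+-assoc (f n) (g n) (h n)
              }
            ; identity = (λ f → exact λ n → ℤₚ.+-identityˡ (f n)) , (λ f → exact λ n → ℤₚ.+-identityʳ (f n))
            }
          ; inverse = (λ f → exact λ n → ℤₚ.+-inverseˡ (f n)) , (λ f → exact λ n → ℤₚ.+-inverseʳ (f n))
          ; ⁻¹-cong = λ f≈ → trunc λ n n<N → -‿∼ (at f≈ n n<N)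
          }
        ; comm = λ f g → exact λ n → ℤₚ.+-comm (f n) (g n)
        }
      ; *-cong = λ f≈ g≈ → trunc λ n n<N → sumTo-∼ (suc n) λ { k (s≤s k≤n) →
          *-∼ (at f≈ k (ℕₚ.≤-<-trans k≤n n<N)) (at g≈ (n ℕ.∸ k) (ℕₚ.≤-<-trans (ℕₚ.m∸n≤m n k) n<N)) }
      ; *-assoc = λ f g h → exact (⊛-assoc f g h)
      ; *-identity = (λ f → exact (⊛-identityˡ f)) , (λ f → exact λ n → ≡.trans (⊛-comm f 𝟙 n) (⊛-identityˡ f n))
      ; distrib = (λ h f g → exact λ n → ≡.trans (⊛-comm h (f ⊕ g) n) (≡.trans (⊛-distribʳ-⊕ h f g n)
                     (≡.cong₂ ℤ._+_ (⊛-comm f h n) (⊛-comm g h n))))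
                , (λ h f g → exact (⊛-distribʳ-⊕ h f g))
      }
    ; *-comm = λ f g → exact (⊛-comm f g)
    }
  }

𝟙⊕𝟙≈0 : ∀ N → 𝟙 ⊕ 𝟙 ≈[ N ] (λ _ → + 0)
𝟙⊕𝟙≈0 N = trunc λ { zero _ → half (+ 1) ≡.refl ; (suc n) _ → ∼-refl }

-- Monomials and constant terms.

q : Series
q = mono (+ 1) 1

q⊛-zero : ∀ f → (q ⊛ f) 0 ≡ + 0
q⊛-zero f = ≡.refl

q⊛-suc : ∀ f n → (q ⊛ f) (suc n) ≡ f n
q⊛-suc f n = ≡.trans (⊛-front q f n) (≡.trans (ℤₚ.+-identityˡ _)
  (≡.trans (⊛-cong {g = f} tail-q (λ _ → ≡.refl) n) (⊛-identityˡ f n)))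
  where
  tail-q : ∀ n → tail q n ≡ 𝟙 n
  tail-q zero    = ≡.refl
  tail-q (suc n) = ≡.refl

mono-below : ∀ c m n → n < m → mono c m n ≡ + 0
mono-below c (suc m) zero    _         = ≡.refl
mono-below c (suc m) (suc n) (s≤s n<m) = mono-below c m n n<m

mono-vanishes : ∀ c {k m} → k ≤ m → mono c m ≈[ k ] (λ _ → + 0)
mono-vanishes c {k} {m} k≤m = trunc λ n n<k → ∼-reflexive (mono-below c m n (ℕₚ.<-≤-trans n<k k≤m))

mono-∼ : ∀ {c d} m n → c ∼ d → mono c m n ∼ mono d m n
mono-∼ zero    zero    c∼d = c∼d
mono-∼ zero    (suc n) c∼d = ∼-refl
mono-∼ (suc m) zero    c∼d = ∼-refl
mono-∼ (suc m) (suc n) c∼d = mono-∼ m n c∼d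

q⊛mono : ∀ m n → (q ⊛ mono (+ 1) m) n ≡ mono (+ 1) (suc m) n
q⊛mono m zero    = ≡.refl
q⊛mono m (suc n) = q⊛-suc (mono (+ 1) m) n

sign∼1 : ∀ n → sign n ∼ + 1
sign∼1 zero    = ∼-refl
sign∼1 (suc n) = ∼-trans (-a∼a (sign n)) (sign∼1 n)

-1∼1 : ℤ.- + 1 ∼ + 1
-1∼1 = -a∼a (+ 1)

constant-⊛ : ∀ f g → f 0 ≡ + 1 → g 0 ≡ + 1 → (f ⊛ g) 0 ≡ + 1
constant-⊛ f g f₀ g₀ rewrite f₀ | g₀ = ≡.refl

constant-pow : ∀ f m → f 0 ≡ + 1 → pow f m 0 ≡ + 1
constant-pow f zero    f₀ = ≡.refl
constant-pow f (suc m) f₀ = constant-⊛ (pow f m) f (constant-pow f m f₀) f₀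

constant-poch : ∀ c j d n → poch c (suc j) d n 0 ≡ + 1
constant-poch c j d zero    = ≡.refl
constant-poch c j d (suc n) = constant-⊛ (poch c (suc j) d n) (𝟙 ⊖ mono c (suc j ℕ.+ d ℕ.* n)) (constant-poch c j d n) ≡.refl

module Mod (N : ℕ) where

  open Char2 (truncated N) (𝟙⊕𝟙≈0 N) public

  q^≈mono : ∀ k → q ^ k ≈ mono (+ 1) k
  q^≈mono zero    = exact λ { zero → ≡.refl ; (suc n) → ≡.refl }
  q^≈mono (suc k) = trans (*-congˡ {q} (q^≈mono k)) (exact (q⊛mono k))

  qᴺ≈0 : q ^ N ≈ 0#
  qᴺ≈0 = trans (q^≈mono N) (mono-vanishes (+ 1) ℕₚ.≤-refl)

  open Nilpotent (truncated N) (𝟙⊕𝟙≈0 N) q N qᴺ≈0 public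

  mono≈q^ : ∀ {c} k → c ∼ + 1 → mono c k ≈ q ^ k
  mono≈q^ k c∼1 = trans (trunc λ n _ → mono-∼ k n c∼1) (sym (q^≈mono k))

  ⊖≈⊕ : ∀ f g → f ⊖ g ≈ f ⊕ g
  ⊖≈⊕ f g = +-congˡ {f} (-x≈x g)

  factor≈ : ∀ {c} k → c ∼ + 1 → 𝟙 ⊖ mono c k ≈ 1# + q ^ k
  factor≈ {c} k c∼1 = trans (⊖≈⊕ 𝟙 (mono c k)) (+-congˡ {𝟙} (mono≈q^ k c∼1))

  pow≈^ : ∀ f m → pow f m ≈ f ^ m
  pow≈^ f zero    = refl
  pow≈^ f (suc m) = trans (*-comm (pow f m) f) (*-congˡ {f} (pow≈^ f m))

-- In `sumInf` the number of terms varies with the coefficient. As `F k` starts at q^k modulo 2, one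
-- common range serves all coefficients below N.
sumInf≈sum : ∀ N F → (∀ k → F k ≈[ k ] (λ _ → + 0)) → sumInf F ≈[ N ] Mod.sum N (suc N) F
sumInf≈sum N F F≈0 = trunc λ n n<N → ∼-trans (∼-reflexive (sumS-coefficient (suc n) n))
  (∼-trans (∼-sym (sumTo-extend (λ k → F k n) (ℕₚ.m<n⇒m<1+n n<N) (λ k n<k → at (F≈0 k) n n<k)))
    (∼-reflexive (≡.sym (sum-coefficient (suc N) n))))
  where
  sumS-coefficient : ∀ m n → sumS m F n ≡ sumTo m (λ k → F k n)
  sumS-coefficient zero    n = ≡.refl
  sumS-coefficient (suc m) n = ≡.cong (ℤ._+ F m n) (sumS-coefficient m n)
  sum-coefficient : ∀ m n → Mod.sum N m F n ≡ sumTo m (λ k → F k n)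
  sum-coefficient zero    n = ≡.refl
  sum-coefficient (suc m) n = ≡.cong (ℤ._+ F m n) (sum-coefficient m n)

pow-vanishes : ∀ g → g 0 ≡ + 0 → ∀ m → pow g m ≈[ m ] (λ _ → + 0)
pow-vanishes g g₀ zero    = trunc λ _ ()
pow-vanishes g g₀ (suc m) = trunc λ { n (s≤s n≤m) → sumTo-zero (suc n) λ { k (s≤s k≤n) → term n n≤m k k≤n } }
  where
  term : ∀ n → n ≤ m → ∀ k → k ≤ n → pow g m k ℤ.* g (n ℕ.∸ k) ∼ + 0
  term n n≤m k k≤n with k ℕ.<? m
  ... | yes k<m = *-∼ (at (pow-vanishes g g₀ m) k k<m) (∼-refl {g (n ℕ.∸ k)})
  -- Now n ≤ m ≤ k, so the second index is 0 and the constant term of `g` vanishes.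
  ... | no  k≮m = ∼-reflexive (≡.trans
        (≡.cong (pow g m k ℤ.*_) (≡.trans (≡.cong g (ℕₚ.m≤n⇒m∸n≡0 (ℕₚ.≤-trans n≤m (ℕₚ.≮⇒≥ k≮m)))) g₀))
        (ℤₚ.*-zeroʳ (pow g m k)))

module Inverse (N : ℕ) where
  open Mod N
  open Solver using (solve; _:=_; _:+_; con)

  geometric : ∀ g m → (1# + g) * sum m (g ^_) ≈ 1# + g ^ m
  geometric g m = trans (sum-*ˡ m (1# + g) (g ^_)) (trans
    (sum-cong m (λ k → trans (distribʳ (g ^ k) 1# g) (+-congʳ (*-identityˡ (g ^ k)))))
    (sum-telescope m (g ^_)))

  -- With g = 1 - f one has f = 1 + g modulo 2, so the geometric sum telescopes to 1 plus a power of
  -- g that starts beyond q^N.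
  inv-inverse : ∀ f → f 0 ≡ + 1 → f ⊛ inv f ≈ 𝟙
  inv-inverse f f₀ = begin
    f ⊛ inv f                       ≈⟨ *-cong f≈1+g (trans (sumInf≈sum N (pow g) (pow-vanishes g g₀)) (sum-cong (suc N) (pow≈^ g))) ⟩
    (1# + g) * sum (suc N) (g ^_)   ≈⟨ geometric g (suc N) ⟩
    1# + g ^ suc N                  ≈⟨ +-congˡ {1#} (trans (sym (pow≈^ g (suc N))) (weaken (ℕₚ.n≤1+n N) (pow-vanishes g g₀ (suc N)))) ⟩
    1# + 0#                         ≈⟨ +-identityʳ 1# ⟩
    𝟙                               ∎
    where
    g = 𝟙 ⊖ f
    g₀ : g 0 ≡ + 0
    g₀ rewrite f₀ = ≡.refl
    f≈1+g : f ≈ 1# + g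
    f≈1+g = x+y≈0⇒x≈y (trans (+-congˡ {f} (+-congˡ {1#} (⊖≈⊕ 𝟙 f)))
      (solve 1 (λ f → f :+ (:1 :+ (:1 :+ f)) := con false) refl f))

  inv-unique : ∀ f g → f 0 ≡ + 1 → f * g ≈ 1# → inv f ≈ g
  inv-unique f g f₀ fg≈1 = inverse-unique {f} (inv-inverse f f₀) fg≈1

poch-stable : ∀ d k j → poch (+ 1) (suc d) (suc d) (j ℕ.+ k) ≈[ k ] poch (+ 1) (suc d) (suc d) k
poch-stable d k zero    = exact λ _ → ≡.refl
poch-stable d k (suc j) = trans (*-cong (poch-stable d k j)
    (trans (factor≈ (suc d ℕ.+ suc d ℕ.* (j ℕ.+ k)) ∼-refl) (1+qᵏ≈1 bound)))
    (*-identityʳ _)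
  where
  open Mod k
  bound : k ≤ suc d ℕ.+ suc d ℕ.* (j ℕ.+ k)
  bound = ℕₚ.≤-trans (ℕₚ.m≤n+m k j) (ℕₚ.≤-trans (ℕₚ.m≤n*m (j ℕ.+ k) (suc d)) (ℕₚ.m≤n+m _ (suc d)))

-- `eulerInf` too uses a number of factors that depends on the coefficient; every further factor is
-- 1 up to that order.
eulerInf≈poch : ∀ d N → eulerInf (suc d) ≈[ N ] poch (+ 1) (suc d) (suc d) N
eulerInf≈poch d N = trunc λ n n<N → ∼-sym (∼-trans
  (∼-reflexive (≡.cong (λ M → poch (+ 1) (suc d) (suc d) M n) (≡.sym (ℕₚ.m∸n+n≡m n<N))))
  (at (poch-stable d (suc n) (N ℕ.∸ suc n)) n ℕₚ.≤-refl))

-- Infinite products and mock theta functions modulo 2.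

E⁻³ : Series
E⁻³ = inv (pow (eulerInf 1) 3)

module Products (N : ℕ) where
  open Mod N
  open Solver using (solve; _:=_; _:+_; _:*_; _:^_)
  open Inverse N

  square-factor : ∀ x → 1# + x * x ≈ (1# + x) * (1# + x)
  square-factor = solve 1 (λ x → :1 :+ x :* x := (:1 :+ x) :* (:1 :+ x)) refl

  interchange : ∀ a b c d → (a * b) * (c * d) ≈ (a * c) * (b * d)
  interchange = solve 4 (λ a b c d → (a :* b) :* (c :* d) := (a :* c) :* (b :* d)) refl

  -- The two signs are independent since this serves Euler's products, with both equal to 1, as well
  -- as the denominator (-q⁴;q⁴)_n of U₀.
  poch-square : ∀ {c c′} → c ∼ + 1 → c′ ∼ + 1 → ∀ j d n →
    poch c (j ℕ.+ j) (d ℕ.+ d) n ≈ poch c′ j d n * poch c′ j d n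
  poch-square c∼1 c′∼1 j d zero    = sym (*-identityˡ 𝟙)
  poch-square {c} {c′} c∼1 c′∼1 j d (suc n) = begin
    poch c (j ℕ.+ j) (d ℕ.+ d) n * (𝟙 ⊖ mono c (j ℕ.+ j ℕ.+ (d ℕ.+ d) ℕ.* n))
      ≈⟨ *-cong (poch-square c∼1 c′∼1 j d n) (factor≈ (j ℕ.+ j ℕ.+ (d ℕ.+ d) ℕ.* n) c∼1) ⟩
    (P * P) * (1# + q ^ (j ℕ.+ j ℕ.+ (d ℕ.+ d) ℕ.* n))
      ≈⟨ *-congˡ {P * P} (+-congˡ {1#} (^-+ q (j ℕ.+ d ℕ.* n) (j ℕ.+ d ℕ.* n) (e j d n))) ⟩
    (P * P) * (1# + q ^ (j ℕ.+ d ℕ.* n) * q ^ (j ℕ.+ d ℕ.* n))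
      ≈⟨ *-congˡ {P * P} (square-factor _) ⟩
    (P * P) * ((1# + q ^ (j ℕ.+ d ℕ.* n)) * (1# + q ^ (j ℕ.+ d ℕ.* n)))
      ≈⟨ *-congˡ {P * P} (*-cong (factor≈ (j ℕ.+ d ℕ.* n) c′∼1) (factor≈ (j ℕ.+ d ℕ.* n) c′∼1)) ⟨
    (P * P) * ((𝟙 ⊖ mono c′ (j ℕ.+ d ℕ.* n)) * (𝟙 ⊖ mono c′ (j ℕ.+ d ℕ.* n)))
      ≈⟨ interchange P P (𝟙 ⊖ mono c′ (j ℕ.+ d ℕ.* n)) (𝟙 ⊖ mono c′ (j ℕ.+ d ℕ.* n)) ⟩
    poch c′ j d (suc n) * poch c′ j d (suc n) ∎
    where
    P = poch c′ j d n
    e : ∀ j d n → j ℕ.+ j ℕ.+ (d ℕ.+ d) ℕ.* n ≡ (j ℕ.+ d ℕ.* n) ℕ.+ (j ℕ.+ d ℕ.* n)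
    e = solve-∀

  eulerInf-square : ∀ d → eulerInf (suc d ℕ.+ suc d) ≈ eulerInf (suc d) * eulerInf (suc d)
  eulerInf-square d = trans (eulerInf≈poch (d ℕ.+ suc d) N)
    (trans (poch-square ∼-refl ∼-refl (suc d) (suc d) N)
      (sym (*-cong (eulerInf≈poch d N) (eulerInf≈poch d N))))

  poch≈o : ∀ {c} → c ∼ + 1 → ∀ n → poch c 1 2 n ≈ o n
  poch≈o c∼1 zero    = refl
  poch≈o c∼1 (suc n) = *-cong (poch≈o c∼1 n) (factor≈ (suc (2 ℕ.* n)) c∼1)

  poch-sign : ∀ {c c′} → c ∼ + 1 → c′ ∼ + 1 → ∀ j d n → poch c j d n ≈ poch c′ j d n
  poch-sign c∼1 c′∼1 j d zero    = refl
  poch-sign c∼1 c′∼1 j d (suc n) = *-cong (poch-sign c∼1 c′∼1 j d n)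
    (trans (factor≈ (j ℕ.+ d ℕ.* n) c∼1) (sym (factor≈ (j ℕ.+ d ℕ.* n) c′∼1)))

  p : ℕ → Series
  p n = inv (poch (+ 1) 2 2 n)

  p-inverse : ∀ n → poch (+ 1) 2 2 n * p n ≈ 1#
  p-inverse n = inv-inverse (poch (+ 1) 2 2 n) (constant-poch (+ 1) 1 2 n)

  p₀ : p 0 ≈ 1#
  p₀ = inv-unique 𝟙 𝟙 ≡.refl (*-identityˡ 𝟙)

  p-step : ∀ n → p n ≈ (1# + q ^ (2 ℕ.* suc n)) * p (suc n)
  p-step n = inv-unique (poch (+ 1) 2 2 n) _ (constant-poch (+ 1) 1 2 n) (begin
    poch (+ 1) 2 2 n * ((1# + q ^ (2 ℕ.* suc n)) * p (suc n))
      ≈⟨ *-assoc (poch (+ 1) 2 2 n) (1# + q ^ (2 ℕ.* suc n)) (p (suc n)) ⟨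
    poch (+ 1) 2 2 n * (1# + q ^ (2 ℕ.* suc n)) * p (suc n)
      ≈⟨ *-congʳ {p (suc n)} (*-congˡ {poch (+ 1) 2 2 n} (trans (factor≈ (2 ℕ.+ 2 ℕ.* n) ∼-refl)
           (reflexive (≡.cong (λ k → 1# + q ^ k) (≡.sym (ℕₚ.*-suc 2 n)))))) ⟨
    poch (+ 1) 2 2 (suc n) * p (suc n)
      ≈⟨ p-inverse (suc n) ⟩
    1# ∎)

  open Bailey p p₀ p-step

  eulerInf≈E : eulerInf 1 ≈ E N
  eulerInf≈E = trans (eulerInf≈poch 0 N) (poch≈E N)
    where
    poch≈E : ∀ n → poch (+ 1) 1 1 n ≈ E n
    poch≈E zero    = refl
    poch≈E (suc n) = *-cong (poch≈E n) (trans (factor≈ (suc (1 ℕ.* n)) ∼-refl)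
      (reflexive (≡.cong (λ k → 1# + q ^ suc k) (ℕₚ.*-identityˡ n))))

  E⁻³≈C : E⁻³ ≈ C
  E⁻³≈C = inv-unique (pow (eulerInf 1) 3) C (constant-pow (eulerInf 1) 3 ≡.refl) (begin
    pow (eulerInf 1) 3 * C            ≈⟨ *-comm (pow (eulerInf 1) 3) C ⟩
    C * pow (eulerInf 1) 3            ≈⟨ *-congˡ {C} (*-cong (*-cong (trans (*-identityˡ (eulerInf 1)) eulerInf≈E) eulerInf≈E) eulerInf≈E) ⟩
    C * (E N * E N * E N)             ≈⟨ C*E³≈1 ⟩
    1#                                ∎)

  inv-square : ∀ f n → f 0 ≡ + 1 → f ≈ poch (+ 1) 2 2 n * poch (+ 1) 2 2 n → inv f ≈ p n * p n
  inv-square f n f₀ f≈ = inv-unique f (p n * p n) f₀ (begin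
    f * (p n * p n)                                           ≈⟨ *-congʳ {p n * p n} f≈ ⟩
    (poch (+ 1) 2 2 n * poch (+ 1) 2 2 n) * (p n * p n)       ≈⟨ interchange (poch (+ 1) 2 2 n) (poch (+ 1) 2 2 n) (p n) (p n) ⟩
    (poch (+ 1) 2 2 n * p n) * (poch (+ 1) 2 2 n * p n)       ≈⟨ *-cong (p-inverse n) (p-inverse n) ⟩
    1# * 1#                                                   ≈⟨ *-identityˡ 1# ⟩
    1#                                                        ∎)

  summand-vanishes : ∀ c k m P I → k ≤ m → mono c m ⊛ P ⊛ I ≈[ k ] (λ _ → + 0)
  summand-vanishes c k m P I k≤m = Mod.*-zero-l k {mono c m ⊛ P} I (Mod.*-zero-l k {mono c m} P (mono-vanishes c k≤m))

  k≤k*k : ∀ k → k ≤ k ℕ.* k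
  k≤k*k zero    = z≤n
  k≤k*k (suc k) = ℕₚ.m≤m*n (suc k) (suc k)

  k≤k*[k+2] : ∀ k → k ≤ k ℕ.* (k ℕ.+ 2)
  k≤k*[k+2] k rewrite ℕₚ.+-comm k 2 = ℕₚ.m≤m*n k (2 ℕ.+ k)

  -- Modulo 2 the denominators (-q²;q²)_n² of μ₂ and (-q⁴;q⁴)_n of U₀ are both (q²;q²)_n², so the
  -- two series have the same summands.
  Y-summand : ∀ c c′ n I → c ∼ + 1 → c′ ∼ + 1 → I ≈ p n * p n →
    mono c (n ℕ.* n) ⊛ poch c′ 1 2 n ⊛ I ≈ t 0 0 n
  Y-summand c c′ n I c∼1 c′∼1 I≈ = begin
    mono c (n ℕ.* n) ⊛ poch c′ 1 2 n ⊛ I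
      ≈⟨ *-cong (*-cong (mono≈q^ (n ℕ.* n) c∼1) (poch≈o c′∼1 n)) I≈ ⟩
    q ^ (n ℕ.* n) * o n * (p n * p n)
      ≈⟨ *-assoc (q ^ (n ℕ.* n) * o n) (p n) (p n) ⟨
    q ^ (n ℕ.* n) * o n * p n * p n
      ≡⟨ ≡.cong₂ (λ k l → q ^ k * o l * p n * p l) (≡.sym (ℕₚ.+-identityʳ (n ℕ.* n))) (≡.sym (ℕₚ.+-identityʳ n)) ⟩
    t 0 0 n ∎

  μ₂≈E⁻³ : μ₂ ≈ E⁻³
  μ₂≈E⁻³ = trans (sumInf≈sum N _ (λ k → summand-vanishes (sign k) k (k ℕ.* k) (poch (+ 1) 1 2 k) (inv (pow (poch (ℤ.- + 1) 2 2 k) 2)) (k≤k*k k)))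
    (trans (sum-cong (suc N) (λ n → Y-summand (sign n) (+ 1) n (inv (pow (poch (ℤ.- + 1) 2 2 n) 2)) (sign∼1 n) ∼-refl
      (inv-square _ n (constant-pow (poch (ℤ.- + 1) 2 2 n) 2 (constant-poch (ℤ.- + 1) 1 2 n))
        (*-cong (trans (*-identityˡ (poch (ℤ.- + 1) 2 2 n)) (poch-sign -1∼1 ∼-refl 2 2 n)) (poch-sign -1∼1 ∼-refl 2 2 n)))))
    (trans (Y≈C 0) (sym E⁻³≈C)))

  U₀≈E⁻³ : U₀ ≈ E⁻³
  U₀≈E⁻³ = trans (sumInf≈sum N _ (λ k → summand-vanishes (+ 1) k (k ℕ.* k) (poch (ℤ.- + 1) 1 2 k) (inv (poch (ℤ.- + 1) 4 4 k)) (k≤k*k k)))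
    (trans (sum-cong (suc N) (λ n → Y-summand (+ 1) (ℤ.- + 1) n (inv (poch (ℤ.- + 1) 4 4 n)) ∼-refl -1∼1
      (inv-square _ n (constant-poch (ℤ.- + 1) 3 4 n) (poch-square -1∼1 ∼-refl 2 2 n))))
    (trans (Y≈C 0) (sym E⁻³≈C)))

  S-summand : ∀ s n m → m ≡ n ℕ.* n ℕ.+ 2 ℕ.* s ℕ.* n →
    mono (+ 1) m ⊛ poch (ℤ.- + 1) 1 2 n ⊛ inv (poch (ℤ.- + 1) 2 2 n) ≈ weight s n * p n
  S-summand s n m ≡.refl = *-cong (*-cong (mono≈q^ m ∼-refl) (poch≈o -1∼1 n))
    (inv-unique (poch (ℤ.- + 1) 2 2 n) (p n) (constant-poch (ℤ.- + 1) 1 2 n)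
      (trans (*-congʳ {p n} (poch-sign -1∼1 ∼-refl 2 2 n)) (p-inverse n)))

  S₀≈S : S₀ ≈ S 0
  S₀≈S = trans (sumInf≈sum N _ (λ k → summand-vanishes (+ 1) k (k ℕ.* k) (poch (ℤ.- + 1) 1 2 k) (inv (poch (ℤ.- + 1) 2 2 k)) (k≤k*k k)))
    (sum-cong (suc N) (λ n → S-summand 0 n (n ℕ.* n) (≡.sym (ℕₚ.+-identityʳ (n ℕ.* n)))))

  S₁≈S : S₁ ≈ S 1
  S₁≈S = trans (sumInf≈sum N _ (λ k → summand-vanishes (+ 1) k (k ℕ.* (k ℕ.+ 2)) (poch (ℤ.- + 1) 1 2 k) (inv (poch (ℤ.- + 1) 2 2 k)) (k≤k*[k+2] k)))
    (sum-cong (suc N) (λ n → S-summand 1 n (n ℕ.* (n ℕ.+ 2)) (e n)))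
    where
    e : ∀ n → n ℕ.* (n ℕ.+ 2) ≡ n ℕ.* n ℕ.+ 2 ℕ.* 1 ℕ.* n
    e = solve-∀

  S₀²+qS₁²≈E⁻³ : S₀ ⊛ S₀ ⊕ q ⊛ (S₁ ⊛ S₁) ≈ E⁻³
  S₀²+qS₁²≈E⁻³ = trans (+-cong (*-cong S₀≈S S₀≈S) (*-congˡ {q} (*-cong S₁≈S S₁≈S))) (trans S₀²+qS₁² (sym E⁻³≈C))

  -- The five hauptmoduln modulo 2.

  pow-constant : ∀ d m → pow (eulerInf (suc d)) m 0 ≡ + 1
  pow-constant d m = constant-pow (eulerInf (suc d)) m ≡.refl

  E4≈𝟙 : E4 ≈ 𝟙
  E4≈𝟙 = trunc λ { zero _ → ∼-refl
                 ; (suc n) _ → half (+ 120 ℤ.* + σ₃ (suc n)) (even (σ₃ (suc n))) }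
    where
    even : ∀ s → + (240 ℕ.* s) ℤ.- + 0 ≡ + 120 ℤ.* + s ℤ.* + 2
    even s = ≡.trans (ℤₚ.+-identityʳ _) (≡.trans (≡.cong +_ (e s)) (≡.trans (ℤₚ.pos-* (120 ℕ.* s) 2) (≡.cong (ℤ._* + 2) (ℤₚ.pos-* 120 s))))
      where
      e : ∀ s → 240 ℕ.* s ≡ 120 ℕ.* s ℕ.* 2
      e = solve-∀

  open Hauptmodul (eulerInf 1) E⁻³ (trans (*-congʳ {E⁻³} (sym (pow≈^ (eulerInf 1) 3))) (inv-inverse (pow (eulerInf 1) 3) (pow-constant 0 3))) public

  e₁ : eulerInf 1 ≈ (eulerInf 1) ^ 1
  e₁ = sym (*-identityʳ (eulerInf 1))

  e₂ : eulerInf 2 ≈ (eulerInf 1) ^ 2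
  e₂ = ^-square 1 (eulerInf 1) (eulerInf 2) ≡.refl e₁ (eulerInf-square 0)

  e₄ : eulerInf 4 ≈ (eulerInf 1) ^ 4
  e₄ = ^-square 2 (eulerInf 2) (eulerInf 4) ≡.refl e₂ (eulerInf-square 1)

  e₈ : eulerInf 8 ≈ (eulerInf 1) ^ 8
  e₈ = ^-square 4 (eulerInf 4) (eulerInf 8) ≡.refl e₄ (eulerInf-square 3)

  e₁₆ : eulerInf 16 ≈ (eulerInf 1) ^ 16
  e₁₆ = ^-square 8 (eulerInf 8) (eulerInf 16) ≡.refl e₈ (eulerInf-square 7)

  pow≈euler^ : ∀ m n {k} x → k ≡ m ℕ.* n → x ≈ (eulerInf 1) ^ m → pow x n ≈ (eulerInf 1) ^ k
  pow≈euler^ m n x eq x≈ = trans (pow≈^ x n) (^-power m n x eq x≈)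

  P₁≈E⁻²⁴ : P₁ ≈ E⁻²⁴
  P₁≈E⁻²⁴ = quotient≈E⁻²⁴ 0 (pow E4 3) (pow (eulerInf 1) 24) (inv (pow (eulerInf 1) 24)) ≡.refl
    (begin
      pow E4 3   ≈⟨ pow≈^ E4 3 ⟩
      E4 ^ 3     ≈⟨ ^-congˡ 3 E4≈𝟙 ⟩
      1# ^ 3     ≈⟨ solve 0 (:1 :^ 3 := :1) refl ⟩
      1#         ∎)
    (pow≈^ (eulerInf 1) 24)
    (inv-inverse (pow (eulerInf 1) 24) (pow-constant 0 24))

  P₂≈E⁻²⁴ : P₂ ≈ E⁻²⁴
  P₂≈E⁻²⁴ = quotient≈E⁻²⁴ 24 (pow (eulerInf 1) 24) (pow (eulerInf 2) 24) (inv (pow (eulerInf 2) 24)) ≡.refl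
    (pow≈^ (eulerInf 1) 24) (pow≈euler^ 2 24 (eulerInf 2) ≡.refl e₂)
    (inv-inverse (pow (eulerInf 2) 24) (pow-constant 1 24))

  P₄≈E⁻²⁴ : P₄ ≈ E⁻²⁴
  P₄≈E⁻²⁴ = quotient≈E⁻²⁴ 8 (pow (eulerInf 1) 8) (pow (eulerInf 4) 8) (inv (pow (eulerInf 4) 8)) ≡.refl
    (pow≈^ (eulerInf 1) 8) (pow≈euler^ 4 8 (eulerInf 4) ≡.refl e₄)
    (inv-inverse (pow (eulerInf 4) 8) (pow-constant 3 8))

  P₈≈E⁻²⁴ : P₈ ≈ E⁻²⁴
  P₈≈E⁻²⁴ = quotient≈E⁻²⁴ 12 X D (inv D) ≡.refl
    (^-product 4 8 (pow (eulerInf 1) 4) (pow (eulerInf 4) 2) ≡.refl (pow≈^ (eulerInf 1) 4) (pow≈euler^ 4 2 (eulerInf 4) ≡.refl e₄))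
    (^-product 4 32 (pow (eulerInf 2) 2) (pow (eulerInf 8) 4) ≡.refl
      (pow≈euler^ 2 2 (eulerInf 2) ≡.refl e₂) (pow≈euler^ 8 4 (eulerInf 8) ≡.refl e₈))
    (inv-inverse D (constant-⊛ (pow (eulerInf 2) 2) (pow (eulerInf 8) 4) (pow-constant 1 2) (pow-constant 7 4)))
    where
    X = pow (eulerInf 1) 4 ⊛ pow (eulerInf 4) 2
    D = pow (eulerInf 2) 2 ⊛ pow (eulerInf 8) 4

  P₁₆≈E⁻²⁴ : P₁₆ ≈ E⁻²⁴
  P₁₆≈E⁻²⁴ = quotient≈E⁻²⁴ 10 X D (inv D) ≡.refl
    (^-product 2 8 (pow (eulerInf 1) 2) (eulerInf 8) ≡.refl (pow≈^ (eulerInf 1) 2) e₈)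
    (^-product 2 32 (eulerInf 2) (pow (eulerInf 16) 2) ≡.refl e₂ (pow≈euler^ 16 2 (eulerInf 16) ≡.refl e₁₆))
    (inv-inverse D (constant-⊛ (eulerInf 2) (pow (eulerInf 16) 2) ≡.refl (pow-constant 15 2)))
    where
    X = pow (eulerInf 1) 2 ⊛ eulerInf 8
    D = eulerInf 2 ⊛ pow (eulerInf 16) 2

-- Coefficients of E⁻³ and E⁻²⁴ by residue class.

everywhere : ∀ {f g} → (∀ N → f ≈[ N ] g) → ∀ n → f n ∼ g n
everywhere f≈g n = at (f≈g (suc n)) n ℕₚ.≤-refl

E⁻³-even : ∀ n → E⁻³ (2 ℕ.* n) ∼ S₀ n
E⁻³-even n = ∼-trans (∼-sym (everywhere Products.S₀²+qS₁²≈E⁻³ (2 ℕ.* n)))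
  (∼-trans (+-∼ (square-even S₀ n) (q-part n)) (∼-reflexive (ℤₚ.+-identityʳ (S₀ n))))
  where
  q-part : ∀ n → (q ⊛ (S₁ ⊛ S₁)) (2 ℕ.* n) ∼ + 0
  q-part zero    = ∼-reflexive (q⊛-zero (S₁ ⊛ S₁))
  q-part (suc n) rewrite ℕₚ.+-suc n (n ℕ.+ 0) =
    ∼-trans (∼-reflexive (q⊛-suc (S₁ ⊛ S₁) (suc (2 ℕ.* n)))) (square-odd S₁ n)

E⁻³-odd : ∀ n → E⁻³ (suc (2 ℕ.* n)) ∼ S₁ n
E⁻³-odd n = ∼-trans (∼-sym (everywhere Products.S₀²+qS₁²≈E⁻³ (suc (2 ℕ.* n))))
  (∼-trans (+-∼ (square-odd S₀ n) (∼-trans (∼-reflexive (q⊛-suc (S₁ ⊛ S₁) (2 ℕ.* n))) (square-even S₁ n)))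
    (∼-reflexive (ℤₚ.+-identityˡ (S₁ n))))

E⁻⁶ E⁻¹² E⁻²⁴ : Series
E⁻⁶ = E⁻³ ⊛ E⁻³
E⁻¹² = E⁻⁶ ⊛ E⁻⁶
E⁻²⁴ = E⁻¹² ⊛ E⁻¹²

P₁∼E⁻²⁴ : ∀ n → P₁ n ∼ E⁻²⁴ n
P₁∼E⁻²⁴ = everywhere Products.P₁≈E⁻²⁴

P₂∼E⁻²⁴ : ∀ n → P₂ n ∼ E⁻²⁴ n
P₂∼E⁻²⁴ = everywhere Products.P₂≈E⁻²⁴

P₄∼E⁻²⁴ : ∀ n → P₄ n ∼ E⁻²⁴ n
P₄∼E⁻²⁴ = everywhere Products.P₄≈E⁻²⁴

P₈∼E⁻²⁴ : ∀ n → P₈ n ∼ E⁻²⁴ n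
P₈∼E⁻²⁴ = everywhere Products.P₈≈E⁻²⁴

P₁₆∼E⁻²⁴ : ∀ n → P₁₆ n ∼ E⁻²⁴ n
P₁₆∼E⁻²⁴ = everywhere Products.P₁₆≈E⁻²⁴

μ₂∼E⁻³ : ∀ n → μ₂ n ∼ E⁻³ n
μ₂∼E⁻³ = everywhere Products.μ₂≈E⁻³

U₀∼E⁻³ : ∀ n → U₀ n ∼ E⁻³ n
U₀∼E⁻³ = everywhere Products.U₀≈E⁻³

E⁻²⁴-8* : ∀ n → E⁻²⁴ (8 ℕ.* n) ∼ E⁻³ n
E⁻²⁴-8* n = ∼-trans (∼-reflexive (≡.cong E⁻²⁴ (e n)))
  (∼-trans (square-even E⁻¹² (2 ℕ.* (2 ℕ.* n))) (∼-trans (square-even E⁻⁶ (2 ℕ.* n)) (square-even E⁻³ n)))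
  where
  e : ∀ n → 8 ℕ.* n ≡ 2 ℕ.* (2 ℕ.* (2 ℕ.* n))
  e = solve-∀

E⁻²⁴-odd : ∀ {m} n → m ≡ suc (2 ℕ.* n) → E⁻²⁴ m ∼ + 0
E⁻²⁴-odd n ≡.refl = square-odd E⁻¹² n

E⁻²⁴-2odd : ∀ {m} n → m ≡ 2 ℕ.* suc (2 ℕ.* n) → E⁻²⁴ m ∼ + 0
E⁻²⁴-2odd n ≡.refl = ∼-trans (square-even E⁻¹² (suc (2 ℕ.* n))) (square-odd E⁻⁶ n)

E⁻²⁴-4odd : ∀ {m} n → m ≡ 2 ℕ.* (2 ℕ.* suc (2 ℕ.* n)) → E⁻²⁴ m ∼ + 0
E⁻²⁴-4odd n ≡.refl = ∼-trans (square-even E⁻¹² (2 ℕ.* suc (2 ℕ.* n)))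
  (∼-trans (square-even E⁻⁶ (suc (2 ℕ.* n))) (square-odd E⁻³ n))

-- For r other than 7 the index is not divisible by 8. Its 2-adic valuation, 0, 1 or 2, is the
-- number of squarings to undo before an odd index of a square is met.
E⁻²⁴-zero : ∀ r k → r < 8 → ¬ r ≡ 7 → E⁻²⁴ (suc (r ℕ.+ k ℕ.* 8)) ∼ + 0
E⁻²⁴-zero 0 k _ _ = E⁻²⁴-odd (4 ℕ.* k) (e k)
  where
  e : ∀ k → suc (k ℕ.* 8) ≡ suc (2 ℕ.* (4 ℕ.* k))
  e = solve-∀
E⁻²⁴-zero 1 k _ _ = E⁻²⁴-2odd (2 ℕ.* k) (e k)
  where
  e : ∀ k → 2 ℕ.+ k ℕ.* 8 ≡ 2 ℕ.* suc (2 ℕ.* (2 ℕ.* k))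
  e = solve-∀
E⁻²⁴-zero 2 k _ _ = E⁻²⁴-odd (4 ℕ.* k ℕ.+ 1) (e k)
  where
  e : ∀ k → 3 ℕ.+ k ℕ.* 8 ≡ suc (2 ℕ.* (4 ℕ.* k ℕ.+ 1))
  e = solve-∀
E⁻²⁴-zero 3 k _ _ = E⁻²⁴-4odd k (e k)
  where
  e : ∀ k → 4 ℕ.+ k ℕ.* 8 ≡ 2 ℕ.* (2 ℕ.* suc (2 ℕ.* k))
  e = solve-∀
E⁻²⁴-zero 4 k _ _ = E⁻²⁴-odd (4 ℕ.* k ℕ.+ 2) (e k)
  where
  e : ∀ k → 5 ℕ.+ k ℕ.* 8 ≡ suc (2 ℕ.* (4 ℕ.* k ℕ.+ 2))
  e = solve-∀
E⁻²⁴-zero 5 k _ _ = E⁻²⁴-2odd (2 ℕ.* k ℕ.+ 1) (e k)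
  where
  e : ∀ k → 6 ℕ.+ k ℕ.* 8 ≡ 2 ℕ.* suc (2 ℕ.* (2 ℕ.* k ℕ.+ 1))
  e = solve-∀
E⁻²⁴-zero 6 k _ _ = E⁻²⁴-odd (4 ℕ.* k ℕ.+ 3) (e k)
  where
  e : ∀ k → 7 ℕ.+ k ℕ.* 8 ≡ suc (2 ℕ.* (4 ℕ.* k ℕ.+ 3))
  e = solve-∀
E⁻²⁴-zero 7 k _ r≢7 = contradiction ≡.refl r≢7
E⁻²⁴-zero (suc (suc (suc (suc (suc (suc (suc (suc r)))))))) k
  (s≤s (s≤s (s≤s (s≤s (s≤s (s≤s (s≤s (s≤s ())))))))) _

-- From coefficients of series to Fourier coefficients.

suc-pred : ∀ k n → 1 ≤ n → suc (suc k ℕ.* n ℕ.∸ 1) ≡ suc k ℕ.* n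
suc-pred k (suc n) _ = ≡.refl

-- The factor q⁻¹ of j shifts the index by one, which is why the progressions 8n - 1, 16n - 1 and
-- 16n + 7 meet multiples of 8.
c₁-8* : ∀ {m} n → suc m ≡ 8 ℕ.* n → c₁ m ∼ E⁻³ n
c₁-8* {m} n m≡ = ∼-trans (P₁∼E⁻²⁴ (suc m)) (∼-trans (∼-reflexive (≡.cong E⁻²⁴ m≡)) (E⁻²⁴-8* n))

open import Data.Nat using (ℕ; _≤_; _*_; _+_; _∸_; _%_)

theorem1p1 : ((n : ℕ) → 1 ≤ n →
    (c₁ n ≡₂ c₂ n) × (c₂ n ≡₂ c₄ n) × (c₄ n ≡₂ c₈ n) × (c₈ n ≡₂ c₁₆ n))
    × ((n : ℕ) → 1 ≤ n → ¬ (n % 8 ≡ 7) → c₁ n ≡₂ + 0)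
    × ((n : ℕ) → 1 ≤ n → (c₁ (8 * n ∸ 1) ≡₂ μ₂ n) × (μ₂ n ≡₂ U₀ n))
    × ((n : ℕ) → 1 ≤ n → c₁ (16 * n ∸ 1) ≡₂ S₀ n)
    × ((n : ℕ) → c₁ (16 * n + 7) ≡₂ S₁ n)
theorem1p1 = hauptmoduln , vanishing , second-order , eighth-order₀ , eighth-order₁
  where
  hauptmoduln : (n : ℕ) → 1 ≤ n → (c₁ n ≡₂ c₂ n) × (c₂ n ≡₂ c₄ n) × (c₄ n ≡₂ c₈ n) × (c₈ n ≡₂ c₁₆ n)
  hauptmoduln n _ =
    ∼⇒≡₂ (c₁ n) (c₂ n) (∼-trans (P₁∼E⁻²⁴ (suc n)) (∼-sym (P₂∼E⁻²⁴ (suc n)))) ,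
    ∼⇒≡₂ (c₂ n) (c₄ n) (∼-trans (P₂∼E⁻²⁴ (suc n)) (∼-sym (P₄∼E⁻²⁴ (suc n)))) ,
    ∼⇒≡₂ (c₄ n) (c₈ n) (∼-trans (P₄∼E⁻²⁴ (suc n)) (∼-sym (P₈∼E⁻²⁴ (suc n)))) ,
    ∼⇒≡₂ (c₈ n) (c₁₆ n) (∼-trans (P₈∼E⁻²⁴ (suc n)) (∼-sym (P₁₆∼E⁻²⁴ (suc n))))

  vanishing : (n : ℕ) → 1 ≤ n → ¬ (n % 8 ≡ 7) → c₁ n ≡₂ + 0
  vanishing n _ n%8≢7 = ∼⇒≡₂ (c₁ n) (+ 0) (∼-trans (P₁∼E⁻²⁴ (suc n))
    (∼-trans (∼-reflexive (≡.cong (λ m → E⁻²⁴ (suc m)) (m≡m%n+[m/n]*n n 8)))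
      (E⁻²⁴-zero (n % 8) (n ℕ./ 8) (m%n<n n 8) n%8≢7)))

  second-order : (n : ℕ) → 1 ≤ n → (c₁ (8 * n ∸ 1) ≡₂ μ₂ n) × (μ₂ n ≡₂ U₀ n)
  second-order n 1≤n =
    ∼⇒≡₂ (c₁ (8 * n ∸ 1)) (μ₂ n) (∼-trans (c₁-8* n (suc-pred 7 n 1≤n)) (∼-sym (μ₂∼E⁻³ n))) ,
    ∼⇒≡₂ (μ₂ n) (U₀ n) (∼-trans (μ₂∼E⁻³ n) (∼-sym (U₀∼E⁻³ n)))

  eighth-order₀ : (n : ℕ) → 1 ≤ n → c₁ (16 * n ∸ 1) ≡₂ S₀ n
  eighth-order₀ n 1≤n = ∼⇒≡₂ (c₁ (16 * n ∸ 1)) (S₀ n)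
    (∼-trans (c₁-8* (2 * n) (≡.trans (suc-pred 15 n 1≤n) (e n))) (E⁻³-even n))
    where
    e : ∀ n → 16 * n ≡ 8 * (2 * n)
    e = solve-∀

  eighth-order₁ : (n : ℕ) → c₁ (16 * n + 7) ≡₂ S₁ n
  eighth-order₁ n = ∼⇒≡₂ (c₁ (16 * n + 7)) (S₁ n) (∼-trans (c₁-8* (suc (2 * n)) (e n)) (E⁻³-odd n))
    where
    e : ∀ n → suc (16 * n + 7) ≡ 8 * suc (2 * n)
    e = solve-∀
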